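{- Let $p\geq 2$ and let $G$ be a finite simple $\{pK_2, K_5-e\}$-free graph. Then $\chi(G)\leq f_p(\omega(G))$, where $f_p:\mathbb{N}\to\mathbb{N}$ ($p\geq2$) is defined as follows. First let $g_p$ ($p\geq2$) be given by $g_t(1)=1$ ($t\geq2$), $g_2(2)=3$, $g_2(m)=m$ ($m\geq3$), $g_p(2)=2p-2$ ($p\geq3$), $g_p(m)=g_{p-1}(m)+2m-2$ ($p,m\geq3$). Then $f_t(1)=1$ for $t\geq 2$; $f_2(2)=3$; $f_2(3)=4$; $f_2(4)=6$; $f_2(s)=s$ for $s\geq 5$; $f_p(2)=2p-2$ and $f_p(3)=2p^2-3p+4$ for $p\geq 3$; and $f_p(m)=f_{p-1}(m)+2g_{p-1}(m-1)+3m-6$ for $p\geq 3$, $m\geq 4$.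
   Context: $\chi(G)$ is the chromatic number and $\omega(G)$ the clique number of $G$. $pK_2$ is the disjoint union of $p$ edges; $K_5-e$ is the complete graph on five vertices minus one edge. A graph is $\mathcal{F}$-free if it has no induced subgraph isomorphic to a member of $\mathcal{F}$. -}

module Defs where

open import Data.Nat using (ℕ; zero; suc; _+_; _*_; _∸_)
open import Data.Bool using (Bool; true; false; _∧_; not)
open import Data.Fin using (Fin; toℕ)
open import Data.Fin.Properties using (_≟_)
open import Data.Product using (Σ; _×_; _,_; ∃)
open import Relation.Nullary using (¬_)
open import Relation.Nullary.Decidable using (⌊_⌋)
open import Relation.Binary.PropositionalEquality using (_≡_; _≢_)
open import Function.Definitions using (Injective)

record Graph (V : Set) : Set where
  field
    adj    : V → V → Bool
    sym    : ∀ x y → adj x y ≡ adj y x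
    irrefl : ∀ x → adj x x ≡ false
open Graph public

InducedSubgraph : {W V : Set} → Graph W → Graph V → Set
InducedSubgraph {W} {V} H G =
  Σ (W → V) λ φ → Injective _≡_ _≡_ φ × (∀ x y → adj H x y ≡ adj G (φ x) (φ y))

Free : {W V : Set} → Graph W → Graph V → Set
Free F G = ¬ InducedSubgraph F G

pK2 : (p : ℕ) → Graph (Fin p × Fin 2)
pK2 p = record { adj = a ; sym = s ; irrefl = ir }
  where
  a : Fin p × Fin 2 → Fin p × Fin 2 → Bool
  a (i , x) (j , y) = ⌊ i ≟ j ⌋ ∧ not ⌊ x ≟ y ⌋
  s : ∀ u v → a u v ≡ a v u
  s (i , Fin.zero) (j , Fin.zero) with i ≟ j | j ≟ i
  ... | Relation.Nullary.yes _ | Relation.Nullary.yes _ = _≡_.refl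
  ... | Relation.Nullary.yes e | Relation.Nullary.no n = Data.Empty.⊥-elim (n (Relation.Binary.PropositionalEquality.sym e))
    where import Data.Empty
  ... | Relation.Nullary.no n | Relation.Nullary.yes e = Data.Empty.⊥-elim (n (Relation.Binary.PropositionalEquality.sym e))
    where import Data.Empty
  ... | Relation.Nullary.no _ | Relation.Nullary.no _ = _≡_.refl
  s (i , Fin.zero) (j , Fin.suc Fin.zero) with i ≟ j | j ≟ i
  ... | Relation.Nullary.yes _ | Relation.Nullary.yes _ = _≡_.refl
  ... | Relation.Nullary.yes e | Relation.Nullary.no n = Data.Empty.⊥-elim (n (Relation.Binary.PropositionalEquality.sym e))
    where import Data.Empty
  ... | Relation.Nullary.no n | Relation.Nullary.yes e = Data.Empty.⊥-elim (n (Relation.Binary.PropositionalEquality.sym e))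
    where import Data.Empty
  ... | Relation.Nullary.no _ | Relation.Nullary.no _ = _≡_.refl
  s (i , Fin.suc Fin.zero) (j , Fin.zero) with i ≟ j | j ≟ i
  ... | Relation.Nullary.yes _ | Relation.Nullary.yes _ = _≡_.refl
  ... | Relation.Nullary.yes e | Relation.Nullary.no n = Data.Empty.⊥-elim (n (Relation.Binary.PropositionalEquality.sym e))
    where import Data.Empty
  ... | Relation.Nullary.no n | Relation.Nullary.yes e = Data.Empty.⊥-elim (n (Relation.Binary.PropositionalEquality.sym e))
    where import Data.Empty
  ... | Relation.Nullary.no _ | Relation.Nullary.no _ = _≡_.refl
  s (i , Fin.suc Fin.zero) (j , Fin.suc Fin.zero) with i ≟ j | j ≟ i
  ... | Relation.Nullary.yes _ | Relation.Nullary.yes _ = _≡_.refl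
  ... | Relation.Nullary.yes e | Relation.Nullary.no n = Data.Empty.⊥-elim (n (Relation.Binary.PropositionalEquality.sym e))
    where import Data.Empty
  ... | Relation.Nullary.no n | Relation.Nullary.yes e = Data.Empty.⊥-elim (n (Relation.Binary.PropositionalEquality.sym e))
    where import Data.Empty
  ... | Relation.Nullary.no _ | Relation.Nullary.no _ = _≡_.refl
  ir : ∀ u → a u u ≡ false
  ir (i , Fin.zero) with i ≟ i
  ... | Relation.Nullary.yes _ = _≡_.refl
  ... | Relation.Nullary.no _ = _≡_.refl
  ir (i , Fin.suc Fin.zero) with i ≟ i
  ... | Relation.Nullary.yes _ = _≡_.refl
  ... | Relation.Nullary.no _ = _≡_.refl

K5-e-adj : Fin 5 → Fin 5 → Bool
K5-e-adj Fin.zero Fin.zero = false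
K5-e-adj Fin.zero (Fin.suc Fin.zero) = false
K5-e-adj Fin.zero (Fin.suc (Fin.suc Fin.zero)) = true
K5-e-adj Fin.zero (Fin.suc (Fin.suc (Fin.suc Fin.zero))) = true
K5-e-adj Fin.zero (Fin.suc (Fin.suc (Fin.suc (Fin.suc Fin.zero)))) = true
K5-e-adj (Fin.suc Fin.zero) Fin.zero = false
K5-e-adj (Fin.suc Fin.zero) (Fin.suc Fin.zero) = false
K5-e-adj (Fin.suc Fin.zero) (Fin.suc (Fin.suc Fin.zero)) = true
K5-e-adj (Fin.suc Fin.zero) (Fin.suc (Fin.suc (Fin.suc Fin.zero))) = true
K5-e-adj (Fin.suc Fin.zero) (Fin.suc (Fin.suc (Fin.suc (Fin.suc Fin.zero)))) = true
K5-e-adj (Fin.suc (Fin.suc Fin.zero)) Fin.zero = true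
K5-e-adj (Fin.suc (Fin.suc Fin.zero)) (Fin.suc Fin.zero) = true
K5-e-adj (Fin.suc (Fin.suc Fin.zero)) (Fin.suc (Fin.suc Fin.zero)) = false
K5-e-adj (Fin.suc (Fin.suc Fin.zero)) (Fin.suc (Fin.suc (Fin.suc Fin.zero))) = true
K5-e-adj (Fin.suc (Fin.suc Fin.zero)) (Fin.suc (Fin.suc (Fin.suc (Fin.suc Fin.zero)))) = true
K5-e-adj (Fin.suc (Fin.suc (Fin.suc Fin.zero))) Fin.zero = true
K5-e-adj (Fin.suc (Fin.suc (Fin.suc Fin.zero))) (Fin.suc Fin.zero) = true
K5-e-adj (Fin.suc (Fin.suc (Fin.suc Fin.zero))) (Fin.suc (Fin.suc Fin.zero)) = true
K5-e-adj (Fin.suc (Fin.suc (Fin.suc Fin.zero))) (Fin.suc (Fin.suc (Fin.suc Fin.zero))) = false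
K5-e-adj (Fin.suc (Fin.suc (Fin.suc Fin.zero))) (Fin.suc (Fin.suc (Fin.suc (Fin.suc Fin.zero)))) = true
K5-e-adj (Fin.suc (Fin.suc (Fin.suc (Fin.suc Fin.zero)))) Fin.zero = true
K5-e-adj (Fin.suc (Fin.suc (Fin.suc (Fin.suc Fin.zero)))) (Fin.suc Fin.zero) = true
K5-e-adj (Fin.suc (Fin.suc (Fin.suc (Fin.suc Fin.zero)))) (Fin.suc (Fin.suc Fin.zero)) = true
K5-e-adj (Fin.suc (Fin.suc (Fin.suc (Fin.suc Fin.zero)))) (Fin.suc (Fin.suc (Fin.suc Fin.zero))) = true
K5-e-adj (Fin.suc (Fin.suc (Fin.suc (Fin.suc Fin.zero)))) (Fin.suc (Fin.suc (Fin.suc (Fin.suc Fin.zero)))) = false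

K5-e : Graph (Fin 5)
K5-e = record { adj = K5-e-adj ; sym = s ; irrefl = ir }
  where
  s : ∀ x y → K5-e-adj x y ≡ K5-e-adj y x
  s Fin.zero Fin.zero = _≡_.refl
  s Fin.zero (Fin.suc Fin.zero) = _≡_.refl
  s Fin.zero (Fin.suc (Fin.suc Fin.zero)) = _≡_.refl
  s Fin.zero (Fin.suc (Fin.suc (Fin.suc Fin.zero))) = _≡_.refl
  s Fin.zero (Fin.suc (Fin.suc (Fin.suc (Fin.suc Fin.zero)))) = _≡_.refl
  s (Fin.suc Fin.zero) Fin.zero = _≡_.refl
  s (Fin.suc Fin.zero) (Fin.suc Fin.zero) = _≡_.refl
  s (Fin.suc Fin.zero) (Fin.suc (Fin.suc Fin.zero)) = _≡_.refl
  s (Fin.suc Fin.zero) (Fin.suc (Fin.suc (Fin.suc Fin.zero))) = _≡_.refl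
  s (Fin.suc Fin.zero) (Fin.suc (Fin.suc (Fin.suc (Fin.suc Fin.zero)))) = _≡_.refl
  s (Fin.suc (Fin.suc Fin.zero)) Fin.zero = _≡_.refl
  s (Fin.suc (Fin.suc Fin.zero)) (Fin.suc Fin.zero) = _≡_.refl
  s (Fin.suc (Fin.suc Fin.zero)) (Fin.suc (Fin.suc Fin.zero)) = _≡_.refl
  s (Fin.suc (Fin.suc Fin.zero)) (Fin.suc (Fin.suc (Fin.suc Fin.zero))) = _≡_.refl
  s (Fin.suc (Fin.suc Fin.zero)) (Fin.suc (Fin.suc (Fin.suc (Fin.suc Fin.zero)))) = _≡_.refl
  s (Fin.suc (Fin.suc (Fin.suc Fin.zero))) Fin.zero = _≡_.refl
  s (Fin.suc (Fin.suc (Fin.suc Fin.zero))) (Fin.suc Fin.zero) = _≡_.refl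
  s (Fin.suc (Fin.suc (Fin.suc Fin.zero))) (Fin.suc (Fin.suc Fin.zero)) = _≡_.refl
  s (Fin.suc (Fin.suc (Fin.suc Fin.zero))) (Fin.suc (Fin.suc (Fin.suc Fin.zero))) = _≡_.refl
  s (Fin.suc (Fin.suc (Fin.suc Fin.zero))) (Fin.suc (Fin.suc (Fin.suc (Fin.suc Fin.zero)))) = _≡_.refl
  s (Fin.suc (Fin.suc (Fin.suc (Fin.suc Fin.zero)))) Fin.zero = _≡_.refl
  s (Fin.suc (Fin.suc (Fin.suc (Fin.suc Fin.zero)))) (Fin.suc Fin.zero) = _≡_.refl
  s (Fin.suc (Fin.suc (Fin.suc (Fin.suc Fin.zero)))) (Fin.suc (Fin.suc Fin.zero)) = _≡_.refl
  s (Fin.suc (Fin.suc (Fin.suc (Fin.suc Fin.zero)))) (Fin.suc (Fin.suc (Fin.suc Fin.zero))) = _≡_.refl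
  s (Fin.suc (Fin.suc (Fin.suc (Fin.suc Fin.zero)))) (Fin.suc (Fin.suc (Fin.suc (Fin.suc Fin.zero)))) = _≡_.refl
  ir : ∀ x → K5-e-adj x x ≡ false
  ir Fin.zero = _≡_.refl
  ir (Fin.suc Fin.zero) = _≡_.refl
  ir (Fin.suc (Fin.suc Fin.zero)) = _≡_.refl
  ir (Fin.suc (Fin.suc (Fin.suc Fin.zero))) = _≡_.refl
  ir (Fin.suc (Fin.suc (Fin.suc (Fin.suc Fin.zero)))) = _≡_.refl

HasClique : {V : Set} → Graph V → ℕ → Set
HasClique {V} G k =
  Σ (Fin k → V) λ c → Injective _≡_ _≡_ c × (∀ i j → i ≢ j → adj G (c i) (c j) ≡ true)

IsCliqueNumber : {V : Set} → Graph V → ℕ → Set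
IsCliqueNumber G w = HasClique G w × ¬ HasClique G (suc w)

-- proper k-colouring exists, i.e. χ(G) ≤ k
Colourable : {V : Set} → Graph V → ℕ → Set
Colourable {V} G k =
  Σ (V → Fin k) λ c → ∀ x y → adj G x y ≡ true → c x ≢ c y

-- g p m (meaningful for p ≥ 2, m ≥ 1; other values are junk 0)
g : ℕ → ℕ → ℕ
g 0 _ = 0
g 1 _ = 0
g (suc (suc p)) 0 = 0
g (suc (suc p)) 1 = 1
g 2 2 = 3
g 2 (suc (suc (suc k))) = suc (suc (suc k))
g (suc (suc (suc p))) 2 = 2 * (suc (suc (suc p))) ∸ 2
g (suc (suc (suc p))) (suc (suc (suc k))) =
  g (suc (suc p)) (suc (suc (suc k))) + (2 * (suc (suc (suc k))) ∸ 2)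

-- f p m (meaningful for p ≥ 2, m ≥ 1; f p 0 = 0, the chromatic number of the empty graph)
f : ℕ → ℕ → ℕ
f 0 _ = 0
f 1 _ = 0
f (suc (suc p)) 0 = 0
f (suc (suc p)) 1 = 1
f 2 2 = 3
f 2 3 = 4
f 2 4 = 6
f 2 (suc (suc (suc (suc (suc s))))) = suc (suc (suc (suc (suc s))))
f (suc (suc (suc p))) 2 = 2 * (suc (suc (suc p))) ∸ 2
f (suc (suc (suc p))) 3 =
  (2 * (suc (suc (suc p))) * (suc (suc (suc p))) + 4) ∸ 3 * (suc (suc (suc p)))
f (suc (suc (suc p))) (suc (suc (suc (suc k)))) =
  f (suc (suc p)) (suc (suc (suc (suc k))))
  + 2 * g (suc (suc p)) (suc (suc (suc k)))
  + (3 * (suc (suc (suc (suc k)))) ∸ 6)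

{-# OPTIONS --safe #-}
module Submission where

-- Everything is proved for all graphs with ω(G) ≤ m, not only for those with ω(G) = m: the induction
-- deletes vertices, and f is not monotone (f 2 5 = 5 < 6 = f 2 4).
--
-- Let G contain a triangle abc. The common neighbourhoods of ab, ac and bc are disjoint unions of cliques,
-- since G has no K5-e, and take m - 2 colours each. The remaining neighbours of a are far from the edge bc,
-- hence (p-1)K2-free, and diamond-free; the same holds for b and ac. The vertices far from ab are
-- (p-1)K2-free. This is the recursion of f; the recursion of g comes in the same way from an edge. What
-- remains are the case p = 2 and the triangle-free 3K2-free graphs. If p = 2 and there is a large clique K,
-- then the vertices outside K are independent and each of them misses a vertex of K.
--
-- The other cases, among them the theorem of Gaspers and Huang that (2K2, K4)-free graphs are 4-colourable,
-- are settled by certificates: lists of graphs H₁, ..., Hᵣ such that no vertex-critical graph of the class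
-- in question contains Hᵢ but none of H₁, ..., Hᵢ₋₁. The reason is that a vertex of Hᵢ dominates another
-- one, or that the graph can be coloured according to the adjacencies to Hᵢ: two kinds of vertices may get
-- the same colour when an edge between them would create a forbidden graph or an earlier Hⱼ.

open import Defs
open import Data.Bool as Bool using (Bool; true; false; if_then_else_)
open import Data.Bool.Properties using (¬-not)
open import Data.Empty using (⊥)
open import Data.Fin as Fin using (Fin; zero; suc; fromℕ<; inject≤; join; splitAt; punchIn; punchOut)
import Data.Fin.Properties as Fin
open import Data.List
  using (List; []; _∷_; _++_; map; length; replicate; filter; take; drop; head; last; lookup; foldr;
         fromMaybe; mapMaybe; allFin; upTo; applyUpTo)
open import Data.List.Properties as List using (length-map; length-take; length-++; length-applyUpTo)
import Data.List.Membership.DecPropositional as DecMembership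
open import Data.List.Membership.Propositional using (_∈_; _∉_; find)
open import Data.List.Membership.Propositional.Properties
  using (∈-filter⁺; ∈-filter⁻; ∈-allFin; ∈-lookup; ∈-upTo⁺; ∈-upTo⁻)
open import Data.List.Relation.Binary.Equality.Propositional using (≋⇒≡)
open import Data.List.Relation.Binary.Pointwise as Pointwise using (Pointwise; []; _∷_)
open import Data.List.Relation.Binary.Sublist.Heterogeneous.Properties using (toPointwise; length-mono-≤)
open import Data.List.Relation.Binary.Sublist.Propositional using (_⊆_; ⊆-refl)
open import Data.List.Relation.Binary.Sublist.Propositional.Properties using (filter⁺; filter-⊆)
open import Data.List.Relation.Unary.All as All using (All; []; _∷_)
import Data.List.Relation.Unary.All.Properties as All
open import Data.List.Relation.Unary.AllPairs as AllPairs using (AllPairs; []; _∷_; allPairs?)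
import Data.List.Relation.Unary.AllPairs.Properties as AllPairs
open import Data.List.Relation.Unary.Any as Any using (Any; here; there; index)
import Data.List.Relation.Unary.Any.Properties as Any
open import Data.List.Relation.Unary.Unique.Propositional using (Unique)
open import Data.List.Relation.Unary.Unique.Propositional.Properties using (allFin⁺)
open import Data.Maybe as Maybe using (Maybe; just; nothing)
open import Data.Maybe.Properties using (≡-dec)
import Data.Maybe.Relation.Unary.All as MaybeAll
import Data.Maybe.Relation.Unary.All.Properties as MaybeAll using (map⁺)
import Data.Maybe.Relation.Unary.Any as MaybeAny
open import Data.Nat as ℕ
  using (ℕ; zero; suc; _+_; _*_; _∸_; _/_; _%_; _≤_; _<_; _≤′_; ≤′-refl; ≤′-step; z≤n; s≤s; _≡ᵇ_; NonZero)
open import Data.Nat.Properties as ℕ using (≤-trans)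
open import Data.Nat.Solver using (module +-*-Solver)
open import Data.Product using (∃; _×_; _,_; proj₁; proj₂; uncurry)
open import Data.Sum using (_⊎_; inj₁; inj₂)
open import Data.Sum.Properties using (inj₁-injective; inj₂-injective)
open import Data.Unit using (⊤; tt)
open import Data.Vec as Vec using (Vec; []; _∷_)
open import Data.Vec.Properties using (lookup∘tabulate; length-toList; toList∘fromList)
open import Function using (_∘_; id)
open import Function.Definitions using (Injective)
open import Level using (0ℓ)
open import Relation.Binary
  using (Rel; Symmetric; DecidableEquality; tri<; tri≈; tri>) renaming (Decidable to Decidable₂)
open import Relation.Binary.PropositionalEquality
  using (_≡_; _≢_; refl; cong; cong₂; subst; subst₂; trans; module ≡-Reasoning) renaming (sym to ≡-sym)
open import Relation.Nullary using (¬_; Dec; yes; no; does; ¬?; contradiction)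
open import Relation.Nullary.Decidable using (_×-dec_; _⊎-dec_; _→-dec_; map′; decidable-stable)
open import Relation.Unary using (Pred; Decidable; _∪_; _∩_)

private variable
  A V W : Set
  N k l m p t : ℕ

-- Lists and decidability

AllPairs-lookup : {R : Rel A 0ℓ} → Symmetric R → ∀ {xs} → AllPairs R xs →
  ∀ i j → i ≢ j → R (lookup xs i) (lookup xs j)
AllPairs-lookup R-sym (_  ∷ _)   zero    zero    i≢j = contradiction refl i≢j
AllPairs-lookup R-sym (x∼ ∷ _)   zero    (suc j) _   = All.lookup x∼ (∈-lookup j)
AllPairs-lookup R-sym (x∼ ∷ _)   (suc i) zero    _   = R-sym (All.lookup x∼ (∈-lookup i))
AllPairs-lookup R-sym (_  ∷ xs∼) (suc i) (suc j) i≢j = AllPairs-lookup R-sym xs∼ i j (i≢j ∘ cong suc)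

AllPairs-∈ : {R : Rel A 0ℓ} → Symmetric R → ∀ {xs x y} → AllPairs R xs → x ∈ xs → y ∈ xs → x ≡ y ⊎ R x y
AllPairs-∈ R-sym (_  ∷ _)   (here refl) (here refl) = inj₁ refl
AllPairs-∈ R-sym (x∼ ∷ _)   (here refl) (there y∈)  = inj₂ (All.lookup x∼ y∈)
AllPairs-∈ R-sym (x∼ ∷ _)   (there x∈)  (here refl) = inj₂ (R-sym (All.lookup x∼ x∈))
AllPairs-∈ R-sym (_  ∷ xs∼) (there x∈)  (there y∈)  = AllPairs-∈ R-sym xs∼ x∈ y∈

Unique⇒lookup-injective : ∀ {xs : List A} → Unique xs → Injective _≡_ _≡_ (lookup xs)
Unique⇒lookup-injective unique {i} {j} eq = decidable-stable (i Fin.≟ j)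
  λ i≢j → AllPairs-lookup (_∘ ≡-sym) unique i j i≢j eq

index-injective : ∀ {xs : List A} {x y} (x∈ : x ∈ xs) (y∈ : y ∈ xs) → index x∈ ≡ index y∈ → x ≡ y
index-injective {xs = xs} {x} {y} x∈ y∈ eq = begin
  x                    ≡⟨ Any.lookup-index x∈ ⟩
  lookup xs (index x∈) ≡⟨ cong (lookup xs) eq ⟩
  lookup xs (index y∈) ≡⟨ Any.lookup-index y∈ ⟨
  y                    ∎
  where open ≡-Reasoning

take-closed⇒length≤ : (P : Pred (List A) 0ℓ) → (∀ n {xs} → P xs → P (take n xs)) →
  (∀ {xs} → P xs → length xs ≢ suc m) → ∀ {xs} → P xs → length xs ≤ m
take-closed⇒length≤ {m = m} P P-take length≢ {xs} pxs = ℕ.≮⇒≥ λ m<length → length≢ (P-take (suc m) pxs)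
  (trans (length-take (suc m) xs) (ℕ.m≤n⇒m⊓n≡m m<length))

length-filter-∁ : {P : Pred A 0ℓ} (P? : Decidable P) → ∀ xs →
  length (filter P? xs) + length (filter (¬? ∘ P?) xs) ≡ length xs
length-filter-∁ P? []       = refl
length-filter-∁ P? (x ∷ xs) with P? x
... | yes _ = cong suc (length-filter-∁ P? xs)
... | no  _ = trans (ℕ.+-suc _ _) (cong suc (length-filter-∁ P? xs))

anyVec? : {P : Pred (Vec (Fin N) m) 0ℓ} → Decidable P → Dec (∃ P)
anyVec? {m = zero}  P? = map′ ([] ,_) (λ { ([] , p) → p }) (P? [])
anyVec? {m = suc m} P? = map′ (λ (x , xs , p) → x ∷ xs , p) (λ { (x ∷ xs , p) → x , xs , p })
  (Fin.any? λ x → anyVec? (P? ∘ (x ∷_)))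

allBelow? : {P : Pred ℕ 0ℓ} → Decidable P → ∀ n → Dec (∀ i → i < n → P i)
allBelow? P? n = map′ (λ all i i<n → All.lookup all (∈-upTo⁺ i<n)) (λ all → All.tabulate (all _ ∘ ∈-upTo⁻))
  (All.all? P? (upTo n))

All-just : {P : Pred A 0ℓ} → ∀ {mx x} → MaybeAll.All P mx → mx ≡ just x → P x
All-just (MaybeAll.just p) refl = p

Any-just : {P : Pred A 0ℓ} → ∀ {mx} → MaybeAny.Any P mx → ∃ λ x → mx ≡ just x × P x
Any-just (MaybeAny.just p) = _ , refl , p

witness : (a? : Dec A) → does a? ≡ true → A
witness (yes a) _ = a

-- Cliques, induced matchings and colourings

module Adjacency {V : Set} (G : Graph V) where

  infix 4 _~_ _≁_ _~?_

  _~_ _≁_ : Rel V 0ℓ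
  x ~ y = adj G x y ≡ true
  x ≁ y = ¬ x ~ y

  _~?_ : Decidable₂ _~_
  x ~? y = adj G x y Bool.≟ true

  ~-sym : Symmetric _~_
  ~-sym {x} {y} x~y = trans (sym G y x) x~y

  ~⇒≢ : ∀ {x y} → x ~ y → x ≢ y
  ~⇒≢ {x} x~x refl with trans (≡-sym x~x) (irrefl G x)
  ... | ()

  ≁-sym : Symmetric _≁_
  ≁-sym x≁y = x≁y ∘ ~-sym

module _ (G : Graph V) where

  open Adjacency G

  Clique : Pred (List V) 0ℓ
  Clique = AllPairs _~_

  Apart : Rel (V × V) 0ℓ
  Apart (u , v) (x , y) = (u ≁ x × u ≁ y) × (v ≁ x × v ≁ y)

  Apart-sym : Symmetric Apart
  Apart-sym ((ux , uy) , (vx , vy)) = (≁-sym ux , ≁-sym vx) , (≁-sym uy , ≁-sym vy)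

  InducedMatching : Pred (List (V × V)) 0ℓ
  InducedMatching es = All (uncurry _~_) es × AllPairs Apart es

  -- SharedCliques≤ t excludes the complete graph on t + 3 vertices minus an edge.
  Cliques≤ InducedMatchings≤ SharedCliques≤ : ℕ → Set
  Cliques≤ m          = ∀ {xs} → Clique xs → length xs ≤ m
  InducedMatchings≤ p = ∀ {es} → InducedMatching es → length es ≤ p
  SharedCliques≤ t    = ∀ {x y zs} → x ≢ y → x ≁ y → Clique zs → All (x ~_) zs → All (y ~_) zs → length zs ≤ t

  Cliques≤⇒SharedCliques≤ : Cliques≤ (suc m) → SharedCliques≤ m
  Cliques≤⇒SharedCliques≤ ω≤ _ _ zs x~zs _ = ℕ.≤-pred (ω≤ (x~zs ∷ zs))

restrict : Graph V → (W → V) → Graph W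
restrict G φ = record
  { adj    = λ x y → adj G (φ x) (φ y)
  ; sym    = λ x y → sym G (φ x) (φ y)
  ; irrefl = λ x → irrefl G (φ x)
  }

module Restriction (G : Graph V) (φ : W → V) where

  open Adjacency G

  private
    H : Graph W
    H = restrict G φ

    edge : W × W → V × V
    edge (u , v) = φ u , φ v

  Cliques≤-restrict : Cliques≤ G m → Cliques≤ H m
  Cliques≤-restrict ω≤ {xs} clique = subst (_≤ _) (length-map φ xs) (ω≤ (AllPairs.map⁺ clique))

  SharedCliques≤-restrict : Injective _≡_ _≡_ φ → SharedCliques≤ G t → SharedCliques≤ H t
  SharedCliques≤-restrict φ-inj τ≤ {zs = zs} x≢y x≁y clique x~zs y~zs = subst (_≤ _) (length-map φ zs)
    (τ≤ (x≢y ∘ φ-inj) x≁y (AllPairs.map⁺ clique) (All.map⁺ x~zs) (All.map⁺ y~zs))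

  InducedMatchings≤-restrict : InducedMatchings≤ G p → InducedMatchings≤ H p
  InducedMatchings≤-restrict μ≤ {es} (edges , apart) = subst (_≤ _) (length-map edge es)
    (μ≤ (All.map⁺ edges , AllPairs.map⁺ apart))

  module _ {a : V} (a~φ : ∀ x → a ~ φ x) where

    private
      a~map : ∀ xs → All (a ~_) (map φ xs)
      a~map xs = All.map⁺ (All.universal a~φ xs)

    Cliques≤-joined : Cliques≤ G (suc m) → Cliques≤ H m
    Cliques≤-joined ω≤ {xs} clique = subst (_≤ _) (length-map φ xs)
      (ℕ.≤-pred (ω≤ (a~map xs ∷ AllPairs.map⁺ clique)))

    SharedCliques≤-joined : Injective _≡_ _≡_ φ → SharedCliques≤ G (suc t) → SharedCliques≤ H t
    SharedCliques≤-joined φ-inj τ≤ {x} {y} {zs} x≢y x≁y clique x~zs y~zs = subst (_≤ _) (length-map φ zs)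
      (ℕ.≤-pred (τ≤ (x≢y ∘ φ-inj) x≁y (a~map zs ∷ AllPairs.map⁺ clique)
        (~-sym (a~φ x) ∷ All.map⁺ x~zs) (~-sym (a~φ y) ∷ All.map⁺ y~zs)))

  InducedMatchings≤-apart : ∀ {u v} → u ~ v → (∀ x → u ≁ φ x × v ≁ φ x) →
    InducedMatchings≤ G (suc p) → InducedMatchings≤ H p
  InducedMatchings≤-apart {u = u} {v} u~v uv≁φ μ≤ {es} (edges , apart) = subst (_≤ _) (length-map edge es)
    (ℕ.≤-pred (μ≤ (u~v ∷ All.map⁺ edges , All.map⁺ (All.universal uv-apart es) ∷ AllPairs.map⁺ apart)))
    where
    uv-apart : ∀ e → Apart G (u , v) (edge e)
    uv-apart (x , y) = (proj₁ (uv≁φ x) , proj₁ (uv≁φ y)) , (proj₂ (uv≁φ x) , proj₂ (uv≁φ y))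

Colourable-mono : (G : Graph V) → k ≤ l → Colourable G k → Colourable G l
Colourable-mono G k≤l (c , proper) = (λ x → inject≤ (c x) k≤l) ,
  λ x y x~y → proper x y x~y ∘ Fin.inject≤-injective k≤l k≤l _ _

Colourable-pullback : (H : Graph W) (G : Graph V) (h : W → V) →
  (∀ x y → adj H x y ≡ true → adj G (h x) (h y) ≡ true) → Colourable G k → Colourable H k
Colourable-pullback H G h h-hom (c , proper) = c ∘ h , λ x y x~y → proper (h x) (h y) (h-hom x y x~y)

ColourableOn : Graph V → Pred V 0ℓ → ℕ → Set
ColourableOn G P k = Colourable (restrict {W = ∃ P} G proj₁) k

ColourableOn-∪ : (G : Graph V) {P Q : Pred V 0ℓ} → Decidable P →
  ColourableOn G P k → ColourableOn G Q l → ColourableOn G (P ∪ Q) (k + l)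
ColourableOn-∪ {V = V} {k = k} {l} G {P} {Q} P? (c , c-proper) (d , d-proper) =
  (λ (x , x∈) → join k l (colour (P? x) x∈)) ,
  λ (x , x∈) (y , y∈) x~y → colour-proper (P? x) x∈ (P? y) y∈ x~y ∘ join-injective
  where
  colour : ∀ {x} → Dec (P x) → (P ∪ Q) x → Fin k ⊎ Fin l
  colour (yes x∈P) _          = inj₁ (c (_ , x∈P))
  colour (no x∉P)  (inj₁ x∈P) = contradiction x∈P x∉P
  colour (no _)    (inj₂ x∈Q) = inj₂ (d (_ , x∈Q))

  colour-proper : ∀ {x y} (x∈P? : Dec (P x)) x∈ (y∈P? : Dec (P y)) y∈ → adj G x y ≡ true →
    colour x∈P? x∈ ≢ colour y∈P? y∈
  colour-proper (no x∉P) (inj₁ x∈P) _        _          _   _  = contradiction x∈P x∉P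
  colour-proper _        _          (no y∉P) (inj₁ y∈P) _   _  = contradiction y∈P y∉P
  colour-proper (yes _)  _          (yes _)  _          x~y eq = c-proper _ _ x~y (inj₁-injective eq)
  colour-proper (no _)   (inj₂ _)   (no _)   (inj₂ _)   x~y eq = d-proper _ _ x~y (inj₂-injective eq)
  colour-proper (yes _)  _          (no _)   (inj₂ _)   _   ()
  colour-proper (no _)   (inj₂ _)   (yes _)  _          _   ()

  join-injective : ∀ {s t} → join k l s ≡ join k l t → s ≡ t
  join-injective {s} {t} eq = begin
    s                      ≡⟨ Fin.splitAt-join k l s ⟨
    splitAt k (join k l s) ≡⟨ cong (splitAt k) eq ⟩
    splitAt k (join k l t) ≡⟨ Fin.splitAt-join k l t ⟩
    t                      ∎
    where open ≡-Reasoning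

ColourableOn-universal : (G : Graph V) {P : Pred V 0ℓ} → (∀ x → P x) → ColourableOn G P k → Colourable G k
ColourableOn-universal G all = Colourable-pullback G (restrict G proj₁) (λ x → x , all x) (λ _ _ x~y → x~y)

module Induced (G : Graph (Fin N)) {P : Pred (Fin N) 0ℓ} (P? : Decidable P) where

  open Adjacency G using (_~_)

  vertices : List (Fin N)
  vertices = filter P? (allFin N)

  vertex : Fin (length vertices) → Fin N
  vertex = lookup vertices

  vertex-injective : Injective _≡_ _≡_ vertex
  vertex-injective = Unique⇒lookup-injective (AllPairs.filter⁺ P? (allFin⁺ N))

  vertex-∈ : ∀ i → P (vertex i)
  vertex-∈ i = All.lookup (All.all-filter P? (allFin N)) (∈-lookup i)

  subgraph : Graph (Fin (length vertices))
  subgraph = restrict G vertex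

  ColourableOn-induced : Colourable subgraph k → ColourableOn G P k
  ColourableOn-induced = Colourable-pullback (restrict G proj₁) subgraph position λ x y →
    subst₂ _~_ (vertex-position x) (vertex-position y)
    where
    x∈vertices : (x : ∃ P) → proj₁ x ∈ vertices
    x∈vertices (x , x∈P) = ∈-filter⁺ P? (∈-allFin x) x∈P
    position : ∃ P → Fin (length vertices)
    position x = index (x∈vertices x)
    vertex-position : ∀ x → proj₁ x ≡ vertex (position x)
    vertex-position x = Any.lookup-index (x∈vertices x)

module _ (G : Graph (Fin N)) where

  open Adjacency G using (_~_; _~?_; ~-sym; ~⇒≢)

  colourable? : ∀ k → Dec (Colourable G k)
  colourable? k = map′ (λ (c , proper) → Vec.lookup c , proper) tabulated
    (anyVec? λ c → Fin.all? λ x → Fin.all? λ y → x ~? y →-dec ¬? (Vec.lookup c x Fin.≟ Vec.lookup c y))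
    where
    tabulated : Colourable G k → ∃ λ c → ∀ x y → x ~ y → Vec.lookup c x ≢ Vec.lookup c y
    tabulated (c , proper) = Vec.tabulate c , λ x y x~y →
      subst₂ _≢_ (≡-sym (lookup∘tabulate c x)) (≡-sym (lookup∘tabulate c y)) (proper x y x~y)

  clique-or-Cliques≤ : ∀ m → (∃ λ xs → length xs ≡ suc m × Clique G xs) ⊎ Cliques≤ G m
  clique-or-Cliques≤ m with anyVec? {m = suc m} (λ xs → allPairs? _~?_ (Vec.toList xs))
  ... | yes (xs , clique) = inj₁ (Vec.toList xs , length-toList xs , clique)
  ... | no none           = inj₂ (take-closed⇒length≤ (Clique G) (λ n → AllPairs.take⁺ n)
    (no-clique λ xs → none ∘ (xs ,_)))
    where
    no-clique : ∀ {n} → (∀ (xs : Vec (Fin N) n) → ¬ Clique G (Vec.toList xs)) →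
      ∀ {ys} → Clique G ys → length ys ≢ n
    no-clique none {ys} clique refl =
      none (Vec.fromList ys) (subst (Clique G) (≡-sym (toList∘fromList ys)) clique)

  -- A vertex is coloured by the number of its smaller neighbours.
  cluster-colouring : (∀ {x y z} → x ~ y → y ~ z → x ≢ z → x ~ z) → Cliques≤ G k → Colourable G k
  cluster-colouring {k} ~-trans ω≤ = (λ x → fromℕ< (bounded x)) ,
    λ x y x~y eq → proper x y x~y (Fin.fromℕ<-injective _ _ (bounded x) (bounded y) eq)
    where
    Below : Fin N → Fin N → Set
    Below x y = y Fin.< x × x ~ y

    below? : ∀ x → Decidable (Below x)
    below? x y = y Fin.<? x ×-dec x ~? y

    below : Fin N → List (Fin N)
    below x = filter (below? x) (allFin N)

    below-clique : ∀ x → Clique G (x ∷ below x)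
    below-clique x =
      All.map proj₂ smaller ∷ neighbours-clique smaller (AllPairs.filter⁺ (below? x) (allFin⁺ N))
      where
      smaller : All (Below x) (below x)
      smaller = All.all-filter (below? x) (allFin N)
      neighbours-clique : ∀ {ys} → All (Below x) ys → Unique ys → Clique G ys
      neighbours-clique []                 []                 = []
      neighbours-clique ((_ , x~y) ∷ ys<x) (y≢ys ∷ ys-unique) =
        All.zipWith (λ (y≢z , _ , x~z) → ~-trans (~-sym x~y) x~z y≢z) (y≢ys , ys<x) ∷
        neighbours-clique ys<x ys-unique

    bounded : ∀ x → length (below x) < k
    bounded x = ω≤ (below-clique x)

    below-mono : ∀ {x y z} → x ~ y → x Fin.< y → Below x z → Below y z
    below-mono x~y x<y (z<x , x~z) = z<y , ~-trans (~-sym x~y) x~z (λ { refl → Fin.<-irrefl refl z<y })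
      where z<y = Fin.<-trans z<x x<y

    proper-< : ∀ {x y} → x ~ y → x Fin.< y → length (below x) ≢ length (below y)
    proper-< {x} {y} x~y x<y eq =
      Fin.<-irrefl refl (proj₁ (proj₂ (∈-filter⁻ (below? x) {xs = allFin N} x∈below-x)))
      where
      below-⊆ : below x ⊆ below y
      below-⊆ = filter⁺ (below? x) (below? y) (λ { refl → below-mono x~y x<y }) (⊆-refl {x = allFin N})
      x∈below-x : x ∈ below x
      x∈below-x = subst (x ∈_) (≡-sym (≋⇒≡ (toPointwise eq below-⊆)))
        (∈-filter⁺ (below? y) (∈-allFin x) (x<y , ~-sym x~y))

    proper : ∀ x y → x ~ y → length (below x) ≢ length (below y)
    proper x y x~y with Fin.<-cmp x y
    ... | tri< x<y _ _ = proper-< x~y x<y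
    ... | tri≈ _ x≡y _ = contradiction x≡y (~⇒≢ x~y)
    ... | tri> _ _ y<x = proper-< (~-sym x~y) y<x ∘ ≡-sym

Critical : Graph (Fin (suc N)) → ℕ → Set
Critical G k = ¬ Colourable G k × ∀ u → Colourable (restrict G (punchIn u)) k

critical-restriction : (G : Graph (Fin N)) → ¬ Colourable G k →
  ∃ λ n → ∃ λ (φ : Fin (suc n) → Fin N) → Injective _≡_ _≡_ φ × Critical (restrict G φ) k
critical-restriction {zero}      G ¬c = contradiction ((λ ()) , λ ()) ¬c
critical-restriction {suc N} {k} G ¬c with Fin.all? (λ u → colourable? (restrict G (punchIn u)) k)
... | yes deleted = N , id , id , ¬c , deleted
... | no ¬deleted with Fin.¬∀⟶∃¬ (suc N) _ (λ u → colourable? (restrict G (punchIn u)) k) ¬deleted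
... | u , ¬c-u with critical-restriction (restrict G (punchIn u)) ¬c-u
... | n , φ , φ-inj , critical = n , punchIn u ∘ φ , φ-inj ∘ Fin.punchIn-injective u _ _ , critical

no-critical-restriction⇒colourable : (G : Graph (Fin N)) →
  (∀ {n} {φ : Fin (suc n) → Fin N} → Injective _≡_ _≡_ φ → ¬ Critical (restrict G φ) k) → Colourable G k
no-critical-restriction⇒colourable {k = k} G none = decidable-stable (colourable? G k) λ ¬c →
  let n , φ , φ-inj , critical = critical-restriction G ¬c in none φ-inj critical

critical⇒undominated : (G : Graph (Fin (suc N))) → let open Adjacency G in
  Critical G k → ∀ {u v} → u ≢ v → u ≁ v → ¬ (∀ w → w ~ u → w ~ v)
critical⇒undominated {N} G (¬c , deleted) {u} {v} u≢v u≁v dominated =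
  ¬c (Colourable-pullback G (restrict G (punchIn u)) retract retract-hom (deleted u))
  where
  open Adjacency G

  onto-v : Fin (suc N) → Fin (suc N)
  onto-v x with u Fin.≟ x
  ... | yes _ = v
  ... | no _  = x

  onto-v-≢u : ∀ x → u ≢ onto-v x
  onto-v-≢u x with u Fin.≟ x
  ... | yes _  = u≢v
  ... | no u≢x = u≢x

  onto-v-hom : ∀ x y → x ~ y → onto-v x ~ onto-v y
  onto-v-hom x y x~y with u Fin.≟ x | u Fin.≟ y
  ... | yes refl | yes refl = contradiction refl (~⇒≢ x~y)
  ... | yes refl | no _     = ~-sym (dominated y (~-sym x~y))
  ... | no _     | yes refl = dominated x x~y
  ... | no _     | no _     = x~y

  retract : Fin (suc N) → Fin N
  retract x = punchOut (onto-v-≢u x)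

  retract-hom : ∀ x y → x ~ y → punchIn u (retract x) ~ punchIn u (retract y)
  retract-hom x y x~y = subst₂ _~_
    (≡-sym (Fin.punchIn-punchOut (onto-v-≢u x))) (≡-sym (Fin.punchIn-punchOut (onto-v-≢u y)))
    (onto-v-hom x y x~y)

-- Common neighbourhoods and large cliques

module _ (G : Graph (Fin N)) where

  open Adjacency G

  CommonNeighbour : List (Fin N) → Pred (Fin N) 0ℓ
  CommonNeighbour K x = All (x ~_) K

  commonNeighbour? : ∀ K → Decidable (CommonNeighbour K)
  commonNeighbour? K x = All.all? (x ~?_) K

  FarFrom : Fin N → Fin N → Pred (Fin N) 0ℓ
  FarFrom u v x = u ≁ x × v ≁ x

  farFrom? : ∀ u v → Decidable (FarFrom u v)
  farFrom? u v x = ¬? (u ~? x) ×-dec ¬? (v ~? x)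

  -- The common neighbourhood of K is a disjoint union of cliques.
  commonNeighbourhood-colouring : ∀ {K} → Clique G K → SharedCliques≤ G (length K) →
    Cliques≤ G (length K + k) → ColourableOn G (CommonNeighbour K) k
  commonNeighbourhood-colouring {k} {K} K-clique τ≤ ω≤ =
    ColourableOn-induced (cluster-colouring subgraph vertex-~-trans ω≤-subgraph)
    where
    open Induced G (commonNeighbour? K)

    vertex-~-trans : ∀ {x y z} → vertex x ~ vertex y → vertex y ~ vertex z → x ≢ z → vertex x ~ vertex z
    vertex-~-trans {x} {y} {z} x~y y~z x≢z = decidable-stable (vertex x ~? vertex z) λ x≁z → ℕ.<-irrefl refl
      (τ≤ (x≢z ∘ vertex-injective) x≁z (vertex-∈ y ∷ K-clique) (x~y ∷ vertex-∈ x) (~-sym y~z ∷ vertex-∈ z))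

    joined-clique : ∀ {xs} → Clique subgraph xs → Clique G (map vertex xs ++ K)
    joined-clique {xs} clique =
      AllPairs.++⁺ (AllPairs.map⁺ clique) K-clique (All.map⁺ (All.universal vertex-∈ xs))

    ω≤-subgraph : Cliques≤ subgraph k
    ω≤-subgraph {xs} clique = ℕ.+-cancelˡ-≤ (length K) (length xs) k (begin
      length K + length xs              ≡⟨ ℕ.+-comm (length K) (length xs) ⟩
      length xs + length K              ≡⟨ cong (_+ length K) (length-map vertex xs) ⟨
      length (map vertex xs) + length K ≡⟨ length-++ (map vertex xs) ⟨
      length (map vertex xs ++ K)       ≤⟨ ω≤ (joined-clique clique) ⟩
      length K + k                      ∎)
      where open ℕ.≤-Reasoning

  module _ {K : List (Fin N)} (K-clique : Clique G K) where

    open DecMembership (Fin._≟_ {N}) using (_∈?_)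

    split-graph-colouring : (∀ {x} → x ∉ K → ∃ λ u → u ∈ K × x ≁ u) →
      (∀ {x y} → x ∉ K → y ∉ K → x ≁ y) → Colourable G (length K)
    split-graph-colouring missed independent = (λ x → index (proj₁ (proj₂ (representative x)))) , proper
      where
      representative : ∀ x → ∃ λ u → u ∈ K × x ≁ u × (x ≡ u ⊎ x ∉ K)
      representative x with x ∈? K
      ... | yes x∈K = x , x∈K , (λ x~x → ~⇒≢ x~x refl) , inj₁ refl
      ... | no x∉K with missed x∉K
      ... | u , u∈K , x≁u = u , u∈K , x≁u , inj₂ x∉K
      proper : ∀ x y → x ~ y →
        index (proj₁ (proj₂ (representative x))) ≢ index (proj₁ (proj₂ (representative y)))
      proper x y x~y eq with representative x | representative y
      ... | u , u∈K , x≁u , x∈ | v , v∈K , y≁v , y∈ with index-injective u∈K v∈K eq | x∈ | y∈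
      ... | refl | inj₁ refl | _         = y≁v (~-sym x~y)
      ... | refl | inj₂ _    | inj₁ refl = x≁u x~y
      ... | refl | inj₂ x∉K  | inj₂ y∉K  = independent x∉K y∉K x~y

    module _ (ω≤ : Cliques≤ G (length K)) where

      missed-vertex : ∀ {x} → x ∉ K → ∃ λ u → u ∈ K × x ≁ u
      missed-vertex {x} x∉K = find (All.¬All⇒Any¬ (x ~?_) K λ x~K → ℕ.<-irrefl refl (ω≤ (x~K ∷ K-clique)))

      few-neighbours : SharedCliques≤ G t → ∀ {x} → x ∉ K → length (filter (x ~?_) K) ≤ t
      few-neighbours τ≤ {x} x∉K with missed-vertex x∉K
      ... | u , u∈K , x≁u = τ≤ (λ { refl → x∉K u∈K }) x≁u
        (AllPairs.filter⁺ (x ~?_) K-clique) (All.all-filter (x ~?_) K) (All.tabulate u~)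
        where
        u~ : ∀ {y} → y ∈ filter (x ~?_) K → u ~ y
        u~ y∈ with ∈-filter⁻ (x ~?_) {xs = K} y∈
        ... | y∈K , x~y with AllPairs-∈ ~-sym K-clique u∈K y∈K
        ... | inj₁ refl = contradiction x~y x≁u
        ... | inj₂ u~y  = u~y

      outside-independent : InducedMatchings≤ G 1 → SharedCliques≤ G t → 2 + (t + t) ≤ length K →
        ∀ {x y} → x ∉ K → y ∉ K → x ≁ y
      outside-independent {t} μ≤ τ≤ large {x} {y} x∉K y∉K x~y = no-missed-pair two-missed
        (AllPairs.filter⁺ (¬? ∘ (y ~?_)) (AllPairs.filter⁺ (¬? ∘ (x ~?_)) K-clique))
        (All.filter⁺ (¬? ∘ (y ~?_)) (All.all-filter (¬? ∘ (x ~?_)) K))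
        (All.all-filter (¬? ∘ (y ~?_)) missed-by-x)
        where
        missed-by-x missed-by-both : List (Fin N)
        missed-by-x    = filter (¬? ∘ (x ~?_)) K
        missed-by-both = filter (¬? ∘ (y ~?_)) missed-by-x

        few-y-neighbours : length (filter (y ~?_) missed-by-x) ≤ t
        few-y-neighbours = ≤-trans
          (length-mono-≤ (filter⁺ (y ~?_) (y ~?_) (λ { refl → id }) (filter-⊆ (¬? ∘ (x ~?_)) K)))
          (few-neighbours τ≤ y∉K)

        two-missed : 2 ≤ length missed-by-both
        two-missed = ℕ.+-cancelˡ-≤ (t + t) 2 (length missed-by-both) (begin
          t + t + 2
            ≡⟨ ℕ.+-comm (t + t) 2 ⟩
          2 + (t + t)
            ≤⟨ large ⟩
          length K
            ≡⟨ length-filter-∁ (x ~?_) K ⟨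
          length (filter (x ~?_) K) + length missed-by-x
            ≤⟨ ℕ.+-monoˡ-≤ (length missed-by-x) (few-neighbours τ≤ x∉K) ⟩
          t + length missed-by-x
            ≡⟨ cong (t +_) (length-filter-∁ (y ~?_) missed-by-x) ⟨
          t + (length (filter (y ~?_) missed-by-x) + length missed-by-both)
            ≤⟨ ℕ.+-monoʳ-≤ t (ℕ.+-monoˡ-≤ (length missed-by-both) few-y-neighbours) ⟩
          t + (t + length missed-by-both)
            ≡⟨ ℕ.+-assoc t t (length missed-by-both) ⟨
          t + t + length missed-by-both ∎)
          where open ℕ.≤-Reasoning

        no-missed-pair : ∀ {us} → 2 ≤ length us → Clique G us → All (x ≁_) us → All (y ≁_) us → ⊥
        no-missed-pair {u ∷ v ∷ _} _ ((u~v ∷ _) ∷ _) (x≁u ∷ x≁v ∷ _) (y≁u ∷ y≁v ∷ _) = ℕ.<-irrefl refl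
          (μ≤ (x~y ∷ u~v ∷ [] , (((x≁u , x≁v) , (y≁u , y≁v)) ∷ []) ∷ [] ∷ []))
        no-missed-pair {_ ∷ []} (s≤s ())

  ω-colourable-from : ∀ b → InducedMatchings≤ G 1 → SharedCliques≤ G t → 1 + (t + t) ≤ b →
    (Cliques≤ G b → Colourable G b) → ∀ {m} → b ≤′ m → Cliques≤ G m → Colourable G m
  ω-colourable-from b μ≤ τ≤ t≤b base ≤′-refl ω≤ = base ω≤
  ω-colourable-from b μ≤ τ≤ t≤b base {suc m} (≤′-step b≤m) ω≤ with clique-or-Cliques≤ G m
  ... | inj₂ ω≤m = Colourable-mono G (ℕ.n≤1+n m) (ω-colourable-from b μ≤ τ≤ t≤b base b≤m ω≤m)
  ... | inj₁ (K , |K|≡1+m , K-clique) = subst (Colourable G) |K|≡1+m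
    (split-graph-colouring K-clique (missed-vertex K-clique ω≤K) (outside-independent K-clique ω≤K μ≤ τ≤
      (subst (2 + _ ≤_) (≡-sym |K|≡1+m) (s≤s (≤-trans t≤b (ℕ.≤′⇒≤ b≤m))))))
    where
    ω≤K : Cliques≤ G (length K)
    ω≤K = subst (Cliques≤ G) (≡-sym |K|≡1+m) ω≤

-- Forbidden induced subgraphs

module _ (G : Graph V) where

  open Adjacency G

  clique-embeds : ∀ {xs} → Clique G xs → HasClique G (length xs)
  clique-embeds {xs} clique =
    lookup xs , Unique⇒lookup-injective (AllPairs.map ~⇒≢ clique) , AllPairs-lookup ~-sym clique

  ¬HasClique⇒Cliques≤ : ¬ HasClique G (suc m) → Cliques≤ G m
  ¬HasClique⇒Cliques≤ none = take-closed⇒length≤ (Clique G) (λ n → AllPairs.take⁺ n)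
    λ clique length≡ → none (subst (HasClique G) length≡ (clique-embeds clique))

  end : V × V → Fin 2 → V
  end (u , v) zero       = u
  end (u , v) (suc zero) = v

  end-~ : ∀ e → uncurry _~_ e → ∀ {x y} → x ≢ y → end e x ~ end e y
  end-~ e u~v {zero}     {zero}     x≢y = contradiction refl x≢y
  end-~ e u~v {zero}     {suc zero} _   = u~v
  end-~ e u~v {suc zero} {zero}     _   = ~-sym u~v
  end-~ e u~v {suc zero} {suc zero} x≢y = contradiction refl x≢y

  end-≁ : ∀ e e′ → Apart G e e′ → ∀ x y → end e x ≁ end e′ y
  end-≁ _ _ ((u≁ , _) , _) zero       zero       = u≁
  end-≁ _ _ ((_ , u≁) , _) zero       (suc zero) = u≁
  end-≁ _ _ (_ , (v≁ , _)) (suc zero) zero       = v≁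
  end-≁ _ _ (_ , (_ , v≁)) (suc zero) (suc zero) = v≁

  matching-embeds : ∀ {es} → InducedMatching G es → InducedSubgraph (pK2 (length es)) G
  matching-embeds {es} (edges , pairs) = φ , φ-injective , φ-preserves
    where
    φ : Fin (length es) × Fin 2 → V
    φ (i , x) = end (lookup es i) x
    same-edge : ∀ i {x y} → x ≢ y → φ (i , x) ~ φ (i , y)
    same-edge i = end-~ (lookup es i) (All.lookup edges (∈-lookup i))
    different-edges : ∀ {i j} → i ≢ j → ∀ x y → φ (i , x) ≁ φ (j , y)
    different-edges {i} {j} i≢j = end-≁ (lookup es i) (lookup es j)
      (AllPairs-lookup (λ {e} {e′} → Apart-sym G {e} {e′}) pairs i j i≢j)
    φ-preserves : ∀ s t → adj (pK2 (length es)) s t ≡ adj G (φ s) (φ t)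
    φ-preserves (i , x) (j , y) with i Fin.≟ j | x Fin.≟ y
    ... | yes refl | yes refl = ≡-sym (irrefl G _)
    ... | yes refl | no x≢y   = ≡-sym (same-edge i x≢y)
    ... | no i≢j   | _        = ≡-sym (¬-not (different-edges i≢j x y))
    opposite-≢ : ∀ (x : Fin 2) → Fin.opposite x ≢ x
    opposite-≢ zero       ()
    opposite-≢ (suc zero) ()
    φ-injective : Injective _≡_ _≡_ φ
    φ-injective {i , x} {j , y} eq with i Fin.≟ j | x Fin.≟ y
    ... | yes refl | yes refl = refl
    ... | yes refl | no x≢y   = contradiction eq (~⇒≢ (same-edge i x≢y))
    ... | no i≢j   | _        = contradiction
      (subst (φ (i , Fin.opposite x) ~_) eq (same-edge i (opposite-≢ x)))
      (different-edges i≢j (Fin.opposite x) y)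

  pK₂-free⇒InducedMatchings≤ : Free (pK2 (suc p)) G → InducedMatchings≤ G p
  pK₂-free⇒InducedMatchings≤ free = take-closed⇒length≤ (InducedMatching G)
    (λ n (edges , pairs) → All.take⁺ n edges , AllPairs.take⁺ n pairs)
    λ matching length≡ → free (subst (λ q → InducedSubgraph (pK2 q) G) length≡ (matching-embeds matching))

  K₅-e-embeds : ∀ {a b x y z} → a ≢ b → a ≁ b → Clique G (x ∷ y ∷ z ∷ []) →
    All (a ~_) (x ∷ y ∷ z ∷ []) → All (b ~_) (x ∷ y ∷ z ∷ []) → InducedSubgraph K5-e G
  K₅-e-embeds {a} {b} {x} {y} {z} a≢b a≁b clique@((x~y ∷ x~z ∷ []) ∷ (y~z ∷ []) ∷ [] ∷ [])
    a~@(a~x ∷ a~y ∷ a~z ∷ []) b~@(b~x ∷ b~y ∷ b~z ∷ []) = φ , Unique⇒lookup-injective distinct , φ-preserves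
    where
    φ : Fin 5 → V
    φ = lookup (a ∷ b ∷ x ∷ y ∷ z ∷ [])
    distinct : Unique (a ∷ b ∷ x ∷ y ∷ z ∷ [])
    distinct = (a≢b ∷ All.map ~⇒≢ a~) ∷ All.map ~⇒≢ b~ ∷ AllPairs.map ~⇒≢ clique
    Preserved : Rel (Fin 5) 0ℓ
    Preserved i j = adj K5-e i j ≡ adj G (φ i) (φ j)
    Preserved-sym : Symmetric Preserved
    Preserved-sym {i} {j} eq = trans (sym K5-e j i) (trans eq (sym G (φ i) (φ j)))
    preserved : AllPairs Preserved (allFin 5)
    preserved =
      (≡-sym (¬-not a≁b) ∷ ≡-sym a~x ∷ ≡-sym a~y ∷ ≡-sym a~z ∷ []) ∷
      (≡-sym b~x ∷ ≡-sym b~y ∷ ≡-sym b~z ∷ []) ∷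
      (≡-sym x~y ∷ ≡-sym x~z ∷ []) ∷ (≡-sym y~z ∷ []) ∷ [] ∷ []
    φ-preserves : ∀ i j → Preserved i j
    φ-preserves i j with AllPairs-∈ Preserved-sym preserved (∈-allFin i) (∈-allFin j)
    ... | inj₁ refl = trans (irrefl K5-e i) (≡-sym (irrefl G (φ i)))
    ... | inj₂ eq   = eq

  K₅-e-free⇒SharedCliques≤ : Free K5-e G → SharedCliques≤ G 2
  K₅-e-free⇒SharedCliques≤ free {zs = []}            _   _   _ _ _ = z≤n
  K₅-e-free⇒SharedCliques≤ free {zs = _ ∷ []}        _   _   _ _ _ = s≤s z≤n
  K₅-e-free⇒SharedCliques≤ free {zs = _ ∷ _ ∷ []}    _   _   _ _ _ = s≤s (s≤s z≤n)
  K₅-e-free⇒SharedCliques≤ free {zs = _ ∷ _ ∷ _ ∷ _} a≢b a≁b clique a~ b~ = contradiction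
    (K₅-e-embeds a≢b a≁b (AllPairs.take⁺ 3 clique) (All.take⁺ 3 a~) (All.take⁺ 3 b~)) free

-- Certificates

nth : A → List A → ℕ → A
nth default []       _       = default
nth default (x ∷ xs) zero    = x
nth default (x ∷ xs) (suc i) = nth default xs i

nth-replicate : (x y : A) → ∀ {i} → i < m → nth x (replicate m y) i ≡ y
nth-replicate x y {zero}  (s≤s _)   = refl
nth-replicate x y {suc i} (s≤s i<m) = nth-replicate x y i<m

position : ℕ → List ℕ → ℕ
position x []       = 0
position x (y ∷ ys) = if x ≡ᵇ y then 0 else suc (position x ys)

-- Row i of a pattern lists the relations of vertex i to the vertices i + 1, i + 2, ...
Relation Row Pattern Embedding : Set
Relation  = Maybe Bool
Row       = List Relation
Pattern   = List Row
Embedding = Pattern × List ℕ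

pattern adjacent = just true
pattern apart    = just false
pattern unknown  = nothing

_≟ᵣ_ : DecidableEquality Relation
_≟ᵣ_ = ≡-dec Bool._≟_

relation : Pattern → ℕ → ℕ → Relation
relation []      _       _       = unknown
relation (r ∷ P) zero    zero    = unknown
relation (r ∷ P) zero    (suc j) = nth unknown r j
relation (r ∷ P) (suc i) zero    = nth unknown r i
relation (r ∷ P) (suc i) (suc j) = relation P i j

cliquePattern : ℕ → Pattern
cliquePattern zero    = []
cliquePattern (suc m) = replicate m adjacent ∷ cliquePattern m

matchingPattern : ℕ → Pattern
matchingPattern zero    = []
matchingPattern (suc p) = (adjacent ∷ replicate (p * 2) apart) ∷ replicate (p * 2) apart ∷ matchingPattern p

sharedCliquePattern : ℕ → Pattern
sharedCliquePattern t = (apart ∷ replicate t adjacent) ∷ replicate t adjacent ∷ cliquePattern t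

module Realisation {V : Set} (G : Graph V) where

  open Adjacency G

  Holds : Relation → V → V → Set
  Holds adjacent x y = x ~ y
  Holds apart    x y = x ≢ y × x ≁ y
  Holds unknown  x y = ⊤

  Holds-sym : ∀ a {x y} → Holds a x y → Holds a y x
  Holds-sym adjacent x~y         = ~-sym x~y
  Holds-sym apart    (x≢y , x≁y) = x≢y ∘ ≡-sym , ≁-sym x≁y
  Holds-sym unknown  _           = tt

  RowHolds : Row → V → (ℕ → V) → Set
  RowHolds r x v = ∀ i → Holds (nth unknown r i) x (v i)

  rowHolds? : DecidableEquality V → ∀ r x v → Dec (RowHolds r x v)
  rowHolds? _≟_ []      x v = yes λ _ → tt
  rowHolds? _≟_ (a ∷ r) x v = map′
    (λ { (holds , row) zero → holds ; (holds , row) (suc i) → row i }) (λ row → row 0 , row ∘ suc)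
    (holds? a ×-dec rowHolds? _≟_ r x (v ∘ suc))
    where
    holds? : ∀ a → Dec (Holds a x (v 0))
    holds? adjacent = x ~? v 0
    holds? apart    = ¬? (x ≟ v 0) ×-dec ¬? (x ~? v 0)
    holds? unknown  = yes tt

  Realises : Pattern → (ℕ → V) → Set
  Realises P v = ∀ i j → Holds (relation P i j) (v i) (v j)

  _◂_ : V → (ℕ → V) → ℕ → V
  (x ◂ v) zero    = x
  (x ◂ v) (suc i) = v i

  RowHolds-∷ : ∀ {a r x y v} → Holds a x y → RowHolds r x v → RowHolds (a ∷ r) x (y ◂ v)
  RowHolds-∷ holds row zero    = holds
  RowHolds-∷ holds row (suc i) = row i

  RowHolds-replicate : ∀ {a x v} → RowHolds (replicate m a) x v → ∀ {i} → i < m → Holds a x (v i)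
  RowHolds-replicate {a = a} row {i} i<m = subst (λ b → Holds b _ _) (nth-replicate unknown a i<m) (row i)

  Realises-∷ : ∀ {r P x v} → RowHolds r x v → Realises P v → Realises (r ∷ P) (x ◂ v)
  Realises-∷ row rel zero    zero    = tt
  Realises-∷ row rel zero    (suc j) = row j
  Realises-∷ {r} row rel (suc i) zero    = Holds-sym (nth unknown r i) (row i)
  Realises-∷ row rel (suc i) (suc j) = rel i j

  Realises-row : ∀ r P {v} → Realises (r ∷ P) v → RowHolds r (v 0) (v ∘ suc)
  Realises-row r P rel i = rel 0 (suc i)

  Realises-tail : ∀ r P {v} → Realises (r ∷ P) v → Realises P (v ∘ suc)
  Realises-tail r P rel i j = rel (suc i) (suc j)

  realised-clique : ∀ m v → Realises (cliquePattern m) v → Clique G (applyUpTo v m)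
  realised-clique zero    v rel = []
  realised-clique (suc m) v rel =
    All.applyUpTo⁺₁ (v ∘ suc) m (RowHolds-replicate (Realises-row (replicate m adjacent) (cliquePattern m) rel)) ∷
    realised-clique m (v ∘ suc) (Realises-tail (replicate m adjacent) (cliquePattern m) rel)

  endpoints : ℕ → (ℕ → V) → List (V × V)
  endpoints zero    v = []
  endpoints (suc p) v = (v 0 , v 1) ∷ endpoints p (v ∘ (2 +_))

  length-endpoints : ∀ p v → length (endpoints p v) ≡ p
  length-endpoints zero    v = refl
  length-endpoints (suc p) v = cong suc (length-endpoints p (v ∘ (2 +_)))

  endpoints-apart : ∀ p {a b v} →
    RowHolds (replicate (p * 2) apart) a v → RowHolds (replicate (p * 2) apart) b v →
    All (Apart G (a , b)) (endpoints p v)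
  endpoints-apart zero    a-row b-row = []
  endpoints-apart (suc p) a-row b-row =
    ((proj₂ (a-row 0) , proj₂ (a-row 1)) , (proj₂ (b-row 0) , proj₂ (b-row 1))) ∷
    endpoints-apart p (a-row ∘ (2 +_)) (b-row ∘ (2 +_))

  realised-matching : ∀ p v → Realises (matchingPattern p) v → InducedMatching G (endpoints p v)
  realised-matching zero    v rel = [] , []
  realised-matching (suc p) v rel with realised-matching p (v ∘ (2 +_)) (λ i j → rel (2 + i) (2 + j))
  ... | edges , pairs = rel 0 1 ∷ edges ,
    endpoints-apart p (λ i → rel 0 (2 + i)) (λ i → rel 1 (2 + i)) ∷ pairs

  realises-clique : ∀ x {ys} → Clique G ys → Realises (cliquePattern (length ys)) (foldr _◂_ (λ _ → x) ys)
  realises-clique x []              = λ _ _ → tt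
  realises-clique x (y~ys ∷ clique) = Realises-∷ (adjacent-row y~ys) (realises-clique x clique)
    where
    adjacent-row : ∀ {y zs} → All (y ~_) zs →
      RowHolds (replicate (length zs) adjacent) y (foldr _◂_ (λ _ → x) zs)
    adjacent-row []           = λ _ → tt
    adjacent-row (y~z ∷ y~zs) = RowHolds-∷ y~z (adjacent-row y~zs)

open Realisation using (Realises)

Avoids : Graph V → Pattern → Set
Avoids G P = ∀ v → ¬ Realises G P v

module _ (G : Graph V) where

  open Realisation G hiding (Realises)
  open Adjacency G

  Cliques≤⇒Avoids : Cliques≤ G m → Avoids G (cliquePattern (suc m))
  Cliques≤⇒Avoids {m} ω≤ v rel = ℕ.1+n≰n
    (subst (_≤ m) (length-applyUpTo v (suc m)) (ω≤ (realised-clique (suc m) v rel)))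

  Avoids⇒Cliques≤ : Avoids G (cliquePattern (suc m)) → Cliques≤ G m
  Avoids⇒Cliques≤ avoids = take-closed⇒length≤ (Clique G) (λ n → AllPairs.take⁺ n)
    λ { {x ∷ xs} clique refl → avoids _ (realises-clique x clique) }

  InducedMatchings≤⇒Avoids : InducedMatchings≤ G p → Avoids G (matchingPattern (suc p))
  InducedMatchings≤⇒Avoids {p} μ≤ v rel = ℕ.1+n≰n
    (subst (_≤ p) (length-endpoints (suc p) v) (μ≤ (realised-matching (suc p) v rel)))

  SharedCliques≤⇒Avoids : SharedCliques≤ G t → Avoids G (sharedCliquePattern (suc t))
  SharedCliques≤⇒Avoids {t} τ≤ v rel = ℕ.1+n≰n (subst (_≤ t) (length-applyUpTo common (suc t))
    (τ≤ (proj₁ (rel 0 1)) (proj₂ (rel 0 1)) (realised-clique (suc t) common λ i j → rel (2 + i) (2 + j))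
      (All.applyUpTo⁺₁ common (suc t) (RowHolds-replicate λ i → rel 0 (2 + i)))
      (All.applyUpTo⁺₁ common (suc t) (RowHolds-replicate λ i → rel 1 (2 + i)))))
    where
    common : ℕ → V
    common = v ∘ (2 +_)

RowEmbeds : Row → ℕ → List ℕ → Pattern → Set
RowEmbeds r i is M = Pointwise (λ a j → a ≡ relation M i j) r is

rowEmbeds? : ∀ r i is M → Dec (RowEmbeds r i is M)
rowEmbeds? r i is M = Pointwise.decidable (λ a j → a ≟ᵣ relation M i j) r is

Embeds : Pattern → List ℕ → Pattern → Set
Embeds []      []       M = ⊤
Embeds (r ∷ P) (i ∷ is) M = RowEmbeds r i is M × Embeds P is M
Embeds _       _        M = ⊥

embeds? : ∀ P is M → Dec (Embeds P is M)
embeds? []      []       M = yes tt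
embeds? (r ∷ P) (i ∷ is) M = rowEmbeds? r i is M ×-dec embeds? P is M
embeds? []      (_ ∷ _)  M = no λ ()
embeds? (_ ∷ _) []       M = no λ ()

module _ {G : Graph V} where

  open Realisation G hiding (Realises)

  RowEmbeds⇒RowHolds : ∀ M {r i is v} → RowEmbeds r i is M → Realises G M v → RowHolds r (v i) (v ∘ nth 0 is)
  RowEmbeds⇒RowHolds M []          rel j       = tt
  RowEmbeds⇒RowHolds M (refl ∷ _)  rel zero    = rel _ _
  RowEmbeds⇒RowHolds M (_ ∷ embed) rel (suc j) = RowEmbeds⇒RowHolds M embed rel j

  Embeds⇒Realises : ∀ P is M {v} → Embeds P is M → Realises G M v → Realises G P (v ∘ nth 0 is)
  Embeds⇒Realises []      []       M _              rel i       j       = tt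
  Embeds⇒Realises (r ∷ P) (_ ∷ is) M (row , embeds) rel zero    zero    = tt
  Embeds⇒Realises (r ∷ P) (_ ∷ is) M (row , embeds) rel zero    (suc j) = RowEmbeds⇒RowHolds M row rel j
  Embeds⇒Realises (r ∷ P) (_ ∷ is) M (row , embeds) rel (suc i) zero    =
    Holds-sym (nth unknown r i) (RowEmbeds⇒RowHolds M row rel i)
  Embeds⇒Realises (r ∷ P) (_ ∷ is) M (row , embeds) rel (suc i) (suc j) = Embeds⇒Realises P is M embeds rel i j

Vacuous : Row → Set
Vacuous = All (_≡ unknown)

vacuous? : Decidable Vacuous
vacuous? = All.all? λ a → a ≟ᵣ unknown

tailOn : Bool → Row → Maybe Row
tailOn b     []             = just []
tailOn b     (unknown ∷ r)  = just r
tailOn true  (adjacent ∷ r) = just r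
tailOn false (apart ∷ r)    = just r
tailOn true  (apart ∷ r)    = nothing
tailOn false (adjacent ∷ r) = nothing

-- Every row of n entries, all of them known, agrees with one of the given rows.
Exhaustive : ℕ → List Row → Set
Exhaustive zero    rows = Any Vacuous rows
Exhaustive (suc n) rows = Any Vacuous rows ⊎
  Exhaustive n (mapMaybe (tailOn false) rows) × Exhaustive n (mapMaybe (tailOn true) rows)

exhaustive? : ∀ n rows → Dec (Exhaustive n rows)
exhaustive? zero    rows = Any.any? vacuous? rows
exhaustive? (suc n) rows = Any.any? vacuous? rows ⊎-dec
  exhaustive? n (mapMaybe (tailOn false) rows) ×-dec exhaustive? n (mapMaybe (tailOn true) rows)

module _ {G : Graph V} where

  open Adjacency G
  open Realisation G hiding (Realises)

  Vacuous-holds : ∀ {r} x v → Vacuous r → RowHolds r x v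
  Vacuous-holds x v []            i       = tt
  Vacuous-holds x v (refl ∷ _)    zero    = tt
  Vacuous-holds x v (_ ∷ vacuous) (suc i) = Vacuous-holds x (v ∘ suc) vacuous i

  tailOn-holds : ∀ b r {r′ x v} → tailOn b r ≡ just r′ →
    Holds (just b) x (v 0) → RowHolds r′ x (v ∘ suc) → RowHolds r x v
  tailOn-holds b     []             _    holds row i       = tt
  tailOn-holds b     (unknown ∷ r)  _    holds row zero    = tt
  tailOn-holds true  (adjacent ∷ r) _    holds row zero    = holds
  tailOn-holds false (apart ∷ r)    _    holds row zero    = holds
  tailOn-holds b     (unknown ∷ r)  refl holds row (suc i) = row i
  tailOn-holds true  (adjacent ∷ r) refl holds row (suc i) = row i
  tailOn-holds false (apart ∷ r)    refl holds row (suc i) = row i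

  tailsOn-hold : ∀ b rows {x v} → Holds (just b) x (v 0) →
    Any (λ r → RowHolds r x (v ∘ suc)) (mapMaybe (tailOn b) rows) → Any (λ r → RowHolds r x v) rows
  tailsOn-hold b (r ∷ rows) holds any with tailOn b r in eq
  tailsOn-hold b (r ∷ rows) holds any         | nothing = there (tailsOn-hold b rows holds any)
  tailsOn-hold b (r ∷ rows) holds (here row)  | just _  = here (tailOn-holds b r eq holds row)
  tailsOn-hold b (r ∷ rows) holds (there any) | just _  = there (tailsOn-hold b rows holds any)

  Exhaustive-holds : ∀ n rows {x v} → Exhaustive n rows → (∀ {i} → i < n → x ≢ v i) →
    Any (λ r → RowHolds r x v) rows
  Exhaustive-holds zero    rows vacuous        _ = Any.map (Vacuous-holds _ _) vacuous
  Exhaustive-holds (suc n) rows (inj₁ vacuous) _ = Any.map (Vacuous-holds _ _) vacuous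
  Exhaustive-holds (suc n) rows {x} {v} (inj₂ (exhaustive₀ , exhaustive₁)) x≢v with x ~? v 0
  ... | yes x~v₀ = tailsOn-hold true  rows x~v₀ (Exhaustive-holds n _ exhaustive₁ (x≢v ∘ s≤s))
  ... | no  x≁v₀ = tailsOn-hold false rows (x≢v (s≤s z≤n) , x≁v₀) (Exhaustive-holds n _ exhaustive₀ (x≢v ∘ s≤s))

only : ℕ → Relation → Row
only i a = replicate i unknown ++ a ∷ []

nth-only : ∀ i a → nth unknown (only i a) i ≡ a
nth-only zero    a = refl
nth-only (suc i) a = nth-only i a

-- The weakest row r for which the given map is an embedding into r ∷ H, where H has n vertices. For a vertex
-- outside the image, position returns length is, so that its relation is unknown.
requiredRow : ℕ → Embedding → Row
requiredRow n (P , is) = map (λ i → relation P (position 0 is) (position (suc i) is)) (upTo n)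

Contains : List Embedding → Pattern → Set
Contains es M = Any (λ (P , is) → Embeds P is M) es

contains? : ∀ es M → Dec (Contains es M)
contains? es M = Any.any? (λ (P , is) → embeds? P is M) es

-- The vertices of the class have the given colour. If there is an exception (t , c), then those of them with a
-- neighbour of row t have colour c instead.
record Class : Set where
  constructor class
  field
    row       : Row
    colour    : ℕ
    exception : Maybe (Row × ℕ)
open Class

colours : Class → List ℕ
colours x = colour x ∷ fromMaybe (Maybe.map proj₂ (exception x))

module Validity (H : Pattern) where

  rowOf : Embedding → Row
  rowOf = requiredRow (length H)

  -- A vertex outside H satisfies one of the rows, unless it extends H to one of the impossible patterns.
  Classified : List Embedding → List Row → Set
  Classified impossible rows = All (λ e → Embeds (proj₁ e) (proj₂ e) (rowOf e ∷ H)) impossible ×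
    Exhaustive (length H) (map rowOf impossible ++ rows)

  classified? : ∀ impossible rows → Dec (Classified impossible rows)
  classified? impossible rows = All.all? (λ e → embeds? (proj₁ e) (proj₂ e) (rowOf e ∷ H)) impossible ×-dec
    exhaustive? (length H) (map rowOf impossible ++ rows)

  record Dominated (u w : ℕ) (impossible : List Embedding) : Set where
    constructor isDominated
    field
      u-apart-w  : relation H u w ≡ apart
      inside     : ∀ i → i < length H → relation H i u ≡ apart ⊎ i ≡ u ⊎ relation H i w ≡ adjacent
      classified : Classified impossible (only u apart ∷ only w adjacent ∷ [])

  dominated? : ∀ u w impossible → Dec (Dominated u w impossible)
  dominated? u w impossible = map′ (λ (a , b , c) → isDominated a b c) (λ (isDominated a b c) → a , b , c)
    ((relation H u w ≟ᵣ apart) ×-dec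
     allBelow? (λ i → (relation H i u ≟ᵣ apart) ⊎-dec i ℕ.≟ u ⊎-dec (relation H i w ≟ᵣ adjacent))
       (length H) ×-dec
     classified? impossible (only u apart ∷ only w adjacent ∷ []))

  Contradictory : Row → Row → Set
  Contradictory r s = ∃ λ i → i < length H ×
    (nth unknown r i ≡ adjacent × nth unknown s i ≡ apart ⊎
     nth unknown r i ≡ apart × nth unknown s i ≡ adjacent)

  contradictory? : ∀ r s → Dec (Contradictory r s)
  contradictory? r s = ℕ.anyUpTo?
    (λ i → ((nth unknown r i ≟ᵣ adjacent) ×-dec (nth unknown s i ≟ᵣ apart)) ⊎-dec
           ((nth unknown r i ≟ᵣ apart) ×-dec (nth unknown s i ≟ᵣ adjacent)))
    (length H)

  -- A vertex of class x with a neighbour of class y falls under the exception of x.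
  Triggers : Class → Class → Set
  Triggers y x = MaybeAny.Any (λ (t , _) → t ≡ row y) (exception x)

  triggers? : ∀ y x → Dec (Triggers y x)
  triggers? y x = MaybeAny.dec (λ (t , _) → List.≡-dec _≟ᵣ_ t (row y)) (exception x)

  module _ (refuted : List Embedding) where

    NonAdjacent : Row → Row → Set
    NonAdjacent r s = Contains refuted ((adjacent ∷ s) ∷ r ∷ H)

    -- No vertex of row r has neighbours both of row s and of row t.
    NotBoth : Row → Row → Row → Set
    NotBoth r s t = Contradictory s t ×
      All (λ a → Contains refuted ((adjacent ∷ a ∷ s) ∷ (adjacent ∷ r) ∷ t ∷ H)) (apart ∷ adjacent ∷ [])

    ExceptionCompatible : Class → Class → Set
    ExceptionCompatible x y = MaybeAll.All (λ (t , c) → c ≡ colour y → NotBoth (row x) (row y) t) (exception x)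

    ExceptionsDiffer : Class → Class → Set
    ExceptionsDiffer x y =
      MaybeAll.All (λ (_ , c) → MaybeAll.All (λ (_ , d) → c ≢ d) (exception y)) (exception x)

    DifferentlyColoured : Class → Class → Set
    DifferentlyColoured x y = (colour x ≡ colour y → Triggers y x ⊎ Triggers x y) ×
      ExceptionCompatible x y × ExceptionCompatible y x × ExceptionsDiffer x y

    Compatible : Class → Class → Set
    Compatible x y = DifferentlyColoured x y ⊎ NonAdjacent (row x) (row y)

    nonAdjacent? : ∀ r s → Dec (NonAdjacent r s)
    nonAdjacent? r s = contains? refuted ((adjacent ∷ s) ∷ r ∷ H)

    notBoth? : ∀ r s t → Dec (NotBoth r s t)
    notBoth? r s t = contradictory? s t ×-dec
      All.all? (λ a → contains? refuted ((adjacent ∷ a ∷ s) ∷ (adjacent ∷ r) ∷ t ∷ H)) (apart ∷ adjacent ∷ [])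

    exceptionCompatible? : ∀ x y → Dec (ExceptionCompatible x y)
    exceptionCompatible? x y =
      MaybeAll.dec (λ (t , c) → c ℕ.≟ colour y →-dec notBoth? (row x) (row y) t) (exception x)

    exceptionsDiffer? : ∀ x y → Dec (ExceptionsDiffer x y)
    exceptionsDiffer? x y =
      MaybeAll.dec (λ (_ , c) → MaybeAll.dec (λ (_ , d) → ¬? (c ℕ.≟ d)) (exception y)) (exception x)

    differentlyColoured? : ∀ x y → Dec (DifferentlyColoured x y)
    differentlyColoured? x y =
      (colour x ℕ.≟ colour y →-dec (triggers? y x ⊎-dec triggers? x y)) ×-dec
      exceptionCompatible? x y ×-dec exceptionCompatible? y x ×-dec exceptionsDiffer? x y

    compatible? : ∀ x y → Dec (Compatible x y)
    compatible? x y = differentlyColoured? x y ⊎-dec nonAdjacent? (row x) (row y)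

  InsideProper : (ℕ → ℕ) → ℕ → ℕ → Set
  InsideProper colourOf i j = colourOf i ≡ colourOf j → i ≡ j ⊎ relation H i j ≡ apart

  insideProper? : ∀ colourOf i j → Dec (InsideProper colourOf i j)
  insideProper? colourOf i j = colourOf i ℕ.≟ colourOf j →-dec (i ℕ.≟ j ⊎-dec (relation H i j ≟ᵣ apart))

  MixedProper : (ℕ → ℕ) → ℕ → Class → Set
  MixedProper colourOf i x = colourOf i ∈ colours x → nth unknown (row x) i ≡ apart

  mixedProper? : ∀ colourOf i x → Dec (MixedProper colourOf i x)
  mixedProper? colourOf i x = (colourOf i ∈? colours x) →-dec (nth unknown (row x) i ≟ᵣ apart)
    where open DecMembership ℕ._≟_ using (_∈?_)

  record Coloured (k : ℕ) (colourOf : ℕ → ℕ)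
                  (impossible : List Embedding) (classes : List Class) (refuted : List Embedding) : Set where
    constructor isColoured
    field
      classified     : Classified impossible (map row classes)
      inside-bounded : ∀ i → i < length H → colourOf i < k
      class-bounded  : All (All (_< k) ∘ colours) classes
      inside-proper  : ∀ i → i < length H → ∀ j → j < length H → InsideProper colourOf i j
      mixed-proper   : ∀ i → i < length H → All (MixedProper colourOf i) classes
      class-proper   : All (λ x → NonAdjacent refuted (row x) (row x)) classes
      classes-proper : AllPairs (Compatible refuted) classes

  coloured? : ∀ k colourOf impossible classes refuted → Dec (Coloured k colourOf impossible classes refuted)
  coloured? k colourOf impossible classes refuted = map′
    (λ (a , b , c , d , e , f , g) → isColoured a b c d e f g)
    (λ (isColoured a b c d e f g) → a , b , c , d , e , f , g)
    (classified? impossible (map row classes) ×-dec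
     allBelow? (λ i → colourOf i ℕ.<? k) (length H) ×-dec
     All.all? (λ x → All.all? (ℕ._<? k) (colours x)) classes ×-dec
     allBelow? (λ i → allBelow? (insideProper? colourOf i) (length H)) (length H) ×-dec
     allBelow? (λ i → All.all? (mixedProper? colourOf i) classes) (length H) ×-dec
     All.all? (λ x → nonAdjacent? refuted (row x) (row x)) classes ×-dec
     allPairs? (compatible? refuted) classes)

open Validity

module Soundness (G : Graph (Fin (suc N))) (H : Pattern) {v : ℕ → Fin (suc N)} (realised : Realises G H v) where

  open Adjacency G
  open Realisation G hiding (Realises)

  AllAvoided : List Embedding → Set
  AllAvoided = All (Avoids G ∘ proj₁)

  Outside : Fin (suc N) → Set
  Outside x = ∀ {i} → i < length H → x ≢ v i

  inside-or-outside : ∀ x → (∃ λ i → i < length H × v i ≡ x) ⊎ Outside x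
  inside-or-outside x with ℕ.anyUpTo? (λ i → v i Fin.≟ x) (length H)
  ... | yes inside = inj₁ inside
  ... | no outside = inj₂ λ i< x≡vi → outside (_ , i< , ≡-sym x≡vi)

  relation-holds : ∀ {i j a} → relation H i j ≡ a → Holds a (v i) (v j)
  relation-holds {i} {j} refl = realised i j

  entry-holds : ∀ r {x i a} → RowHolds r x v → nth unknown r i ≡ a → Holds a x (v i)
  entry-holds r {i = i} row refl = row i

  not-contained : ∀ {es M u} → AllAvoided es → Contains es M → ¬ Realises G M u
  not-contained avoided contains realised-M with All.lookupAny avoided contains
  ... | avoids , embeds = avoids _ (Embeds⇒Realises _ _ _ embeds realised-M)

  outside-classified : ∀ {impossible rows} → AllAvoided impossible → Classified H impossible rows →
    ∀ {x} → Outside x → Any (λ r → RowHolds r x v) rows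
  outside-classified {impossible} avoided (embeds , exhaustive) outside
    with Any.++⁻ (map (rowOf H) impossible) (Exhaustive-holds (length H) _ exhaustive outside)
  ... | inj₂ row = row
  ... | inj₁ row with All.lookupAny (All.zip (avoided , embeds)) (Any.map⁻ row)
  ...   | (avoids , extends) , row′ =
    contradiction (Embeds⇒Realises _ _ _ extends (Realises-∷ row′ realised)) (avoids _)

  Dominated⇒¬Critical : ∀ {u w impossible} → AllAvoided impossible → Dominated H u w impossible → ¬ Critical G k
  Dominated⇒¬Critical {u = u} {w} avoided (isDominated u-apart-w inside classified) critical =
    critical⇒undominated G critical (proj₁ vu-apart-vw) (proj₂ vu-apart-vw) dominates
    where
    vu-apart-vw : Holds apart (v u) (v w)
    vu-apart-vw = relation-holds u-apart-w
    dominates : ∀ x → x ~ v u → x ~ v w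
    dominates x x~u with inside-or-outside x
    dominates x x~u | inj₁ (i , i< , refl) with inside i i<
    ... | inj₁ i-apart-u           = contradiction x~u (proj₂ (relation-holds i-apart-u))
    ... | inj₂ (inj₁ refl)         = contradiction refl (~⇒≢ x~u)
    ... | inj₂ (inj₂ i-adjacent-w) = relation-holds i-adjacent-w
    dominates x x~u | inj₂ outside with outside-classified avoided classified outside
    ... | here row         = contradiction x~u (proj₂ (entry-holds (only u apart) row (nth-only u apart)))
    ... | there (here row) = entry-holds (only w adjacent) row (nth-only w adjacent)

  HasNeighbour : Fin (suc N) → Row → Set
  HasNeighbour x t = ∃ λ z → RowHolds t z v × x ~ z

  Usual : Fin (suc N) → Class → Set
  Usual x X = MaybeAll.All (λ (t , _) → ¬ HasNeighbour x t) (exception X)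

  data HasColour (x : Fin (suc N)) (X : Class) : ℕ → Set where
    usual       : Usual x X → HasColour x X (colour X)
    exceptional : ∀ {t c} → exception X ≡ just (t , c) → HasNeighbour x t → HasColour x X c

  hasColour : ∀ x X → ∃ (HasColour x X)
  hasColour x X with exception X in eq
  ... | nothing      = colour X , usual (subst (MaybeAll.All _) (≡-sym eq) MaybeAll.nothing)
  ... | just (t , c) with Fin.any? (λ z → rowHolds? Fin._≟_ t z v ×-dec x ~? z)
  ...   | yes neighbour = c , exceptional eq neighbour
  ...   | no none       = colour X , usual (subst (MaybeAll.All _) (≡-sym eq) (MaybeAll.just none))

  HasColour⇒∈ : ∀ {x X c} → HasColour x X c → c ∈ colours X
  HasColour⇒∈ (usual _)          = here refl
  HasColour⇒∈ (exceptional eq _) rewrite eq = there (here refl)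

  Usual⇒≁-trigger : ∀ {x y X Y} → Usual x X → Triggers H Y X → RowHolds (row Y) y v → x ≁ y
  Usual⇒≁-trigger x-usual triggers y-row x~y with Any-just triggers
  ... | (t , _) , eq , refl = All-just x-usual eq (_ , y-row , x~y)

  Contradictory⇒≢ : ∀ r s {x y} → Contradictory H r s → RowHolds r x v → RowHolds s y v → x ≢ y
  Contradictory⇒≢ r s (i , _ , inj₁ (r-adjacent , s-apart)) r-row s-row refl =
    proj₂ (entry-holds s s-row s-apart) (entry-holds r r-row r-adjacent)
  Contradictory⇒≢ r s (i , _ , inj₂ (r-apart , s-adjacent)) r-row s-row refl =
    proj₂ (entry-holds r r-row r-apart) (entry-holds s s-row s-adjacent)

  extended-realised : ∀ a {r s t x y z} → RowHolds r x v → RowHolds s y v → RowHolds t z v →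
    x ~ y → x ~ z → Holds a y z → Realises G ((adjacent ∷ a ∷ s) ∷ (adjacent ∷ r) ∷ t ∷ H) (y ◂ (x ◂ (z ◂ v)))
  extended-realised a x-row y-row z-row x~y x~z y-z =
    Realises-∷ (RowHolds-∷ (~-sym x~y) (RowHolds-∷ {a = a} y-z y-row))
      (Realises-∷ (RowHolds-∷ x~z x-row) (Realises-∷ z-row realised))

  module _ {refuted} (avoided : AllAvoided refuted) where

    nonAdjacent : ∀ {r s x y} → NonAdjacent H refuted r s → RowHolds r x v → RowHolds s y v → x ≁ y
    nonAdjacent contains x-row y-row x~y = not-contained avoided contains
      (Realises-∷ (RowHolds-∷ (~-sym x~y) y-row) (Realises-∷ x-row realised))

    notBoth : ∀ {r s t x y z} → NotBoth H refuted r s t → RowHolds r x v → RowHolds s y v → RowHolds t z v →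
      x ~ y → x ~ z → ⊥
    notBoth {s = s} {t} {y = y} {z} (contradictory , contains₀ ∷ contains₁ ∷ []) x-row y-row z-row x~y x~z
      with y ~? z
    ... | yes y~z = not-contained avoided contains₁ (extended-realised adjacent x-row y-row z-row x~y x~z y~z)
    ... | no y≁z  = not-contained avoided contains₀ (extended-realised apart x-row y-row z-row x~y x~z
      (Contradictory⇒≢ s t contradictory y-row z-row , y≁z))

    differentlyColoured : ∀ {X Y x y c d} → DifferentlyColoured H refuted X Y →
      RowHolds (row X) x v → RowHolds (row Y) y v → HasColour x X c → HasColour y Y d → c ≡ d → x ≁ y
    differentlyColoured {X} {Y} (same , _) x-row y-row (usual x-usual) (usual y-usual) c≡d x~y with same c≡d
    ... | inj₁ x-triggered = Usual⇒≁-trigger {X = X} {Y} x-usual x-triggered y-row x~y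
    ... | inj₂ y-triggered = Usual⇒≁-trigger {X = Y} {X} y-usual y-triggered x-row (~-sym x~y)
    differentlyColoured (_ , compatible , _) x-row y-row (exceptional eq (z , z-row , x~z)) (usual _) c≡d x~y =
      notBoth (All-just compatible eq c≡d) x-row y-row z-row x~y x~z
    differentlyColoured (_ , _ , compatible , _) x-row y-row (usual _) (exceptional eq (z , z-row , y~z)) c≡d x~y =
      notBoth (All-just compatible eq (≡-sym c≡d)) y-row x-row z-row (~-sym x~y) y~z
    differentlyColoured (_ , _ , _ , differ) x-row y-row (exceptional x-eq _) (exceptional y-eq _) c≡d _ =
      All-just (All-just differ x-eq) y-eq c≡d

  module _ {colourOf : ℕ → ℕ} {impossible classes refuted}
    (impossible-avoided : AllAvoided impossible) (refuted-avoided : AllAvoided refuted)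
    (coloured : Coloured H k colourOf impossible classes refuted) where

    open Coloured coloured

    data Place (x : Fin (suc N)) : ℕ → Set where
      inside  : ∀ i → i < length H → v i ≡ x → Place x (colourOf i)
      inClass : ∀ {X c} → X ∈ classes → RowHolds (row X) x v → HasColour x X c → Place x c

    place : ∀ x → ∃ (Place x)
    place x with inside-or-outside x
    ... | inj₁ (i , i< , vi≡x) = colourOf i , inside i i< vi≡x
    ... | inj₂ outside with find (Any.map⁻ (outside-classified impossible-avoided classified outside))
    ...   | X , X∈ , x-row with hasColour x X
    ...     | c , x-colour = c , inClass X∈ x-row x-colour

    bounded : ∀ {x c} → Place x c → c < k
    bounded (inside i i< _)         = inside-bounded i i<
    bounded (inClass X∈ _ x-colour) = All.lookup (All.lookup class-bounded X∈) (HasColour⇒∈ x-colour)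

    mixed : ∀ {i x X c} → i < length H → X ∈ classes → RowHolds (row X) x v → HasColour x X c →
      colourOf i ≡ c → x ≁ v i
    mixed {X = X} i< X∈ x-row x-colour refl =
      proj₂ (entry-holds (row X) x-row (All.lookup (mixed-proper _ i<) X∈ (HasColour⇒∈ x-colour)))

    Separated : Class → Class → Set
    Separated X Y = ∀ {x y c d} → RowHolds (row X) x v → RowHolds (row Y) y v →
      HasColour x X c → HasColour y Y d → c ≡ d → x ≁ y

    Separated-sym : ∀ {X Y} → Separated X Y → Separated Y X
    Separated-sym separated y-row x-row y-colour x-colour c≡d =
      ≁-sym (separated x-row y-row x-colour y-colour (≡-sym c≡d))

    NonAdjacent⇒Separated : ∀ {X Y} → NonAdjacent H refuted (row X) (row Y) → Separated X Y
    NonAdjacent⇒Separated nonadjacent x-row y-row _ _ _ = nonAdjacent refuted-avoided nonadjacent x-row y-row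

    Compatible⇒Separated : ∀ {X Y} → Compatible H refuted X Y → Separated X Y
    Compatible⇒Separated         (inj₁ differently) = differentlyColoured refuted-avoided differently
    Compatible⇒Separated {X} {Y} (inj₂ nonadjacent) = NonAdjacent⇒Separated {X} {Y} nonadjacent

    separated : ∀ {X Y} → X ∈ classes → Y ∈ classes → Separated X Y
    separated {X} {Y} X∈ Y∈ with AllPairs-∈ (λ {X} {Y} → Separated-sym {X} {Y})
      (AllPairs.map (λ {X} {Y} → Compatible⇒Separated {X} {Y}) classes-proper) X∈ Y∈
    ... | inj₁ refl = NonAdjacent⇒Separated {X} {X} (All.lookup class-proper X∈)
    ... | inj₂ X⊥Y  = X⊥Y

    proper : ∀ {x y c d} → Place x c → Place y d → c ≡ d → x ≁ y
    proper (inside i i< refl) (inside j j< refl) c≡d with inside-proper i i< j j< c≡d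
    ... | inj₁ refl      = λ x~x → ~⇒≢ x~x refl
    ... | inj₂ i-apart-j = proj₂ (relation-holds i-apart-j)
    proper (inside i i< refl)          (inClass Y∈ y-row y-colour) c≡d = ≁-sym (mixed i< Y∈ y-row y-colour c≡d)
    proper (inClass X∈ x-row x-colour) (inside j j< refl)          c≡d = mixed j< X∈ x-row x-colour (≡-sym c≡d)
    proper (inClass X∈ x-row x-colour) (inClass Y∈ y-row y-colour) c≡d =
      separated X∈ Y∈ x-row y-row x-colour y-colour c≡d

    Coloured⇒Colourable : Colourable G k
    Coloured⇒Colourable = (λ x → fromℕ< (bounded (proj₂ (place x)))) , λ x y x~y eq →
      proper (proj₂ (place x)) (proj₂ (place y)) (Fin.fromℕ<-injective _ _ _ _ eq) x~y

digits : (base : ℕ) .{{_ : NonZero base}} → ℕ → ℕ → List ℕ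
digits base m n = collect m n []
  where
  collect : ℕ → ℕ → List ℕ → List ℕ
  collect zero    n ds = ds
  collect (suc m) n ds = collect m (n / base) (n % base ∷ ds)

-- Rows are written with the digits 0 (apart), 1 (adjacent) and 2 (unknown), leading zeros included.
decodeRow : ℕ → ℕ → Row
decodeRow m n = map toRelation (digits 10 m n)
  where
  toRelation : ℕ → Relation
  toRelation 0 = apart
  toRelation 1 = adjacent
  toRelation _ = unknown

decodeGraph : List ℕ → Pattern
decodeGraph []       = []
decodeGraph (n ∷ ns) = decodeRow (length ns) n ∷ decodeGraph ns

-- The i-th list contains the rows of the classes of colour i without an exception. In (n , t , c , d), the row n
-- has colour c with exception (t , d).
decodeClasses : ℕ → List (List ℕ) → List (ℕ × ℕ × ℕ × ℕ) → List Class
decodeClasses m nss exceptional = from 0 nss ++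
  map (λ (n , t , c , d) → class (decodeRow m n) c (just (decodeRow m t , d))) exceptional
  where
  from : ℕ → List (List ℕ) → List Class
  from c []         = []
  from c (ns ∷ nss) = map (λ n → class (decodeRow m n) c nothing) ns ++ from (suc c) nss

-- The last two hexadecimal digits are the position of the embedded pattern in Ps, the others the images of its
-- vertices. Positions outside Ps are ignored.
decodeEmbeddings : List Pattern → List ℕ → List Embedding
decodeEmbeddings Ps = mapMaybe λ n →
  Maybe.map (λ P → P , digits 16 (length P) (n / 256)) (head (drop (n % 256) Ps))

data Step : Set where
  dominated : (graph : List ℕ) (u w : ℕ) (impossible : List ℕ) → Step
  coloured  : (graph colouring impossible : List ℕ) (classes : List (List ℕ)) (refuted : List ℕ)
              (exceptional : List (ℕ × ℕ × ℕ × ℕ)) → Step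

graphOf : Step → Pattern
graphOf (dominated graph _ _ _)    = decodeGraph graph
graphOf (coloured graph _ _ _ _ _) = decodeGraph graph

Valid : ℕ → List Pattern → Step → Set
Valid k Ps (dominated graph u w impossible) =
  Dominated (decodeGraph graph) u w (decodeEmbeddings Ps impossible)
Valid k Ps (coloured graph colouring impossible classes refuted exceptional) =
  Coloured (decodeGraph graph) k (nth 0 colouring) (decodeEmbeddings Ps impossible)
    (decodeClasses (length graph) classes exceptional) (decodeEmbeddings Ps refuted)

valid? : ∀ k Ps s → Dec (Valid k Ps s)
valid? k Ps (dominated graph u w impossible) =
  dominated? (decodeGraph graph) u w (decodeEmbeddings Ps impossible)
valid? k Ps (coloured graph colouring impossible classes refuted exceptional) =
  coloured? (decodeGraph graph) k (nth 0 colouring) (decodeEmbeddings Ps impossible)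
    (decodeClasses (length graph) classes exceptional) (decodeEmbeddings Ps refuted)

ValidSteps : ℕ → List Pattern → List Step → Set
ValidSteps k Ps []       = ⊤
ValidSteps k Ps (s ∷ ss) = Valid k Ps s × ValidSteps k (Ps ++ graphOf s ∷ []) ss

validSteps? : ∀ k Ps ss → Dec (ValidSteps k Ps ss)
validSteps? k Ps []       = yes tt
validSteps? k Ps (s ∷ ss) = valid? k Ps s ×-dec validSteps? k (Ps ++ graphOf s ∷ []) ss

module _ {G : Graph (Fin (suc N))} (critical : Critical G k) where

  decoded-avoided : ∀ {Ps} → All (Avoids G) Ps → ∀ ns → All (Avoids G ∘ proj₁) (decodeEmbeddings Ps ns)
  decoded-avoided avoided ns = All.mapMaybe⁺ (All.map⁺ (All.universal
    (λ n → MaybeAll.map⁺ (All.head⁺ (All.drop⁺ (n % 256) avoided))) ns))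

  Valid⇒Avoids : ∀ {Ps} s → All (Avoids G) Ps → Valid k Ps s → Avoids G (graphOf s)
  Valid⇒Avoids (dominated graph u w impossible) avoided valid v realised =
    Dominated⇒¬Critical (decoded-avoided avoided impossible) valid critical
    where open Soundness G (decodeGraph graph) realised
  Valid⇒Avoids (coloured graph _ impossible _ refuted _) avoided valid v realised = proj₁ critical
    (Coloured⇒Colourable (decoded-avoided avoided impossible) (decoded-avoided avoided refuted) valid)
    where open Soundness G (decodeGraph graph) realised

  ValidSteps⇒Avoids : ∀ {Ps} ss → All (Avoids G) Ps → ValidSteps k Ps ss → All (Avoids G ∘ graphOf) ss
  ValidSteps⇒Avoids []       avoided _                = []
  ValidSteps⇒Avoids (s ∷ ss) avoided (valid , valids) =
    avoids ∷ ValidSteps⇒Avoids ss (All.++⁺ avoided (avoids ∷ [])) valids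
    where
    avoids : Avoids G (graphOf s)
    avoids = Valid⇒Avoids s avoided valid

Avoids-restrict : (G : Graph V) {φ : W → V} → Injective _≡_ _≡_ φ → ∀ P → Avoids G P → Avoids (restrict G φ) P
Avoids-restrict G {φ} φ-injective P avoids v realised =
  avoids (φ ∘ v) λ i j → holds (relation P i j) (realised i j)
  where
  holds : ∀ a {x y} → Realisation.Holds (restrict G φ) a x y → Realisation.Holds G a (φ x) (φ y)
  holds adjacent x~y         = x~y
  holds apart    (x≢y , x≁y) = x≢y ∘ φ-injective , x≁y
  holds unknown  _           = tt

record Certificate (k : ℕ) (Ps : List Pattern) (Q : Pattern) : Set where
  field
    steps      : List Step
    steps-✓    : does (validSteps? k Ps steps) ≡ true
    last-graph : Maybe.map graphOf (last steps) ≡ just Q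

  critical-avoids : {G : Graph (Fin (suc N))} → Critical G k → All (Avoids G) Ps → Avoids G Q
  critical-avoids {G = G} critical avoided = All-just (MaybeAll.map⁺ (All.last⁺ all-avoided)) last-graph
    where
    all-avoided : All (Avoids G ∘ graphOf) steps
    all-avoided = ValidSteps⇒Avoids critical steps avoided (witness (validSteps? k Ps steps) steps-✓)

  certified-colouring : (G : Graph (Fin N)) → All (Avoids G) Ps →
    (∀ {n} {φ : Fin (suc n) → Fin N} → Injective _≡_ _≡_ φ →
      Avoids (restrict G φ) Q → Colourable (restrict G φ) k) →
    Colourable G k
  certified-colouring G avoided avoids-Q⇒colourable =
    no-critical-restriction⇒colourable G λ φ-injective critical →
      proj₁ critical (avoids-Q⇒colourable φ-injective
        (critical-avoids critical (All.map (λ {P} → Avoids-restrict G φ-injective P) avoided)))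

certificate⇒colourable : ∀ {Ps} → Certificate k Ps [] → (G : Graph (Fin N)) → All (Avoids G) Ps → Colourable G k
certificate⇒colourable certificate G avoided = Certificate.certified-colouring certificate G avoided
  λ _ avoids → contradiction (λ _ _ → tt) (avoids λ _ → zero)

ChromaticBound : (p t m k : ℕ) → Set
ChromaticBound p t m k = ∀ {N} (G : Graph (Fin N)) →
  InducedMatchings≤ G p → SharedCliques≤ G t → Cliques≤ G m → Colourable G k

2K₂-diamond-K₄-steps : List Step
2K₂-diamond-K₄-steps =
  coloured (11 ∷ 1 ∷ 0 ∷ []) (0 ∷ 1 ∷ 2 ∷ [])
    (0x0123_01 ∷ 0x0213_01 ∷ 0x0312_01 ∷ 0x0123_02 ∷ [])
    ((002 ∷ []) ∷ (200 ∷ []) ∷ (020 ∷ []) ∷ [])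
    (0x0123_00 ∷ 0x0134_00 ∷ 0x0124_00 ∷ []) [] ∷
  coloured (1 ∷ 0 ∷ []) (1 ∷ 0 ∷ [])
    (0x012_03 ∷ [])
    ((10 ∷ []) ∷ (01 ∷ []) ∷ (00 ∷ []) ∷ [])
    (0x012_03 ∷ 0x013_03 ∷ 0x0123_00 ∷ []) [] ∷
  coloured [] []
    []
    ((0 ∷ []) ∷ [])
    (0x01_04 ∷ []) [] ∷
  []

2K₂-K₄-steps : List Step
2K₂-K₄-steps =
  dominated (0000001 ∷ 110000 ∷ 01101 ∷ 1011 ∷ 110 ∷ 11 ∷ 1 ∷ 0 ∷ []) 4 7
    (0x0518_00 ∷ 0x0123_00 ∷ 0x0268_00 ∷ 0x0356_01 ∷ 0x0124_00 ∷ 0x0278_00 ∷ 0x0457_01 ∷ 0x0167_00 ∷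
     0x0567_01 ∷ []) ∷
  dominated (000000 ∷ 11001 ∷ 0101 ∷ 011 ∷ 11 ∷ 1 ∷ 0 ∷ []) 0 1
    (0x0123_00 ∷ 0x0124_00 ∷ 0x0127_00 ∷ 0x0357_01 ∷ 0x0156_00 ∷ 0x0467_01 ∷ []) ∷
  dominated (000000 ∷ 11000 ∷ 0101 ∷ 011 ∷ 11 ∷ 1 ∷ 0 ∷ []) 0 1
    (0x0123_00 ∷ 0x0124_00 ∷ 0x0156_00 ∷ 0x0357_01 ∷ 0x0157_00 ∷ 0x0167_00 ∷ 0x0467_01 ∷ 0x12347560_02 ∷ []) ∷
  dominated (0000110 ∷ 000111 ∷ 11110 ∷ 1101 ∷ 011 ∷ 01 ∷ 1 ∷ 0 ∷ []) 2 7
    (0x0328_00 ∷ 0x0148_00 ∷ 0x0345_01 ∷ 0x0158_00 ∷ 0x0245_00 ∷ 0x1208345_04 ∷ 0x1208354_04 ∷ []) ∷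
  dominated (0100100 ∷ 000111 ∷ 10011 ∷ 1110 ∷ 111 ∷ 01 ∷ 1 ∷ 0 ∷ []) 1 4
    (0x0245_00 ∷ 0x0157_00 ∷ 0x0213_00 ∷ 0x0347_01 ∷ 0x0158_00 ∷ 0x0356_00 ∷ 0x0268_01 ∷ 0x0278_01 ∷
     0x1024857_04 ∷ []) ∷
  dominated (0010010 ∷ 010110 ∷ 01011 ∷ 1001 ∷ 101 ∷ 11 ∷ 1 ∷ 0 ∷ []) 1 7
    (0x0238_00 ∷ 0x0258_00 ∷ 0x0168_00 ∷ 0x0267_01 ∷ 0x0517_00 ∷ 0x12358076_05 ∷ 0x1206385_04 ∷ []) ∷
  dominated (110000 ∷ 01110 ∷ 1101 ∷ 011 ∷ 11 ∷ 1 ∷ 0 ∷ []) 3 4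
    (0x0156_00 ∷ 0x0246_01 ∷ 0x0712_00 ∷ 0x0157_00 ∷ 0x0347_01 ∷ 0x0237_00 ∷ 0x0326_00 ∷ 0x0613_00 ∷
     0x0467_01 ∷ 0x0123675_04 ∷ 0x10567234_05 ∷ 0x10257364_06 ∷ 0x10356274_06 ∷ []) ∷
  dominated (100100 ∷ 00011 ∷ 0111 ∷ 111 ∷ 01 ∷ 1 ∷ 0 ∷ []) 2 3
    (0x0146_00 ∷ 0x0312_00 ∷ 0x0245_00 ∷ 0x0357_01 ∷ 0x0147_00 ∷ 0x0367_01 ∷ 0x1250763_08 ∷
     0x10426357_07 ∷ []) ∷
  dominated (000110 ∷ 00110 ∷ 1101 ∷ 011 ∷ 01 ∷ 1 ∷ 0 ∷ []) 0 1
    (0x0134_00 ∷ 0x0326_00 ∷ 0x0425_00 ∷ 0x0137_00 ∷ 0x0147_00 ∷ 0x0357_01 ∷ 0x0467_01 ∷ 0x2560734_08 ∷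
     0x2504637_09 ∷ 0x2603547_09 ∷ []) ∷
  coloured (100010011 ∷ 00001111 ∷ 0011111 ∷ 011111 ∷ 11111 ∷ 1010 ∷ 001 ∷ 11 ∷ 0 ∷ 0 ∷ [])
    (2 ∷ 1 ∷ 1 ∷ 1 ∷ 1 ∷ 3 ∷ 2 ∷ 2 ∷ 0 ∷ 0 ∷ [])
    (0x068a_00 ∷ 0x0a69_00 ∷ 0x0289_01 ∷ 0x0412_00 ∷ 0x0367_01 ∷ 0x0789_00 ∷ 0x0512_00 ∷ 0x0137_00 ∷
     0x027a_01 ∷ 0x038a_01 ∷ 0x097a_00 ∷ 0x062a_00 ∷ 0x0236_00 ∷ 0x0628_00 ∷ 0x0467_01 ∷ 0x0157_00 ∷
     0x0312_00 ∷ 0x028a_01 ∷ 0x0719_00 ∷ 0x0246_00 ∷ 0x012a_01 ∷ 0x0567_01 ∷ 0x068347a_08 ∷ 0x0783569_08 ∷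
     0x19a3407_08 ∷ 0x0816_00 ∷ 0x061328a_04 ∷ 0x068357a_08 ∷ 0x068457a_08 ∷ 0x09a3467_08 ∷ 0x16a3408_08 ∷
     0x16a4508_08 ∷ 0x3401792_0a ∷ [])
    ((2212202100 ∷ 2222200200 ∷ 2212120100 ∷ 2222102100 ∷ []) ∷ (0000022121 ∷ 2000021121 ∷ 0000021221 ∷ []) ∷
     (0122220021 ∷ []) ∷ (1222202212 ∷ []) ∷ [])
    (0x017a_00 ∷ 0x0123_00 ∷ 0x0149_01 ∷ 0x019b_01 ∷ 0x018b_00 ∷ 0x0169_01 ∷ 0x018b_01 ∷ 0x013b_01 ∷
     0x012a_01 ∷ []) [] ∷
  dominated (001100011 ∷ 01011110 ∷ 0011111 ∷ 011101 ∷ 11111 ∷ 0011 ∷ 011 ∷ 11 ∷ 0 ∷ 0 ∷ []) 2 4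
    (0x0315_00 ∷ 0x025a_00 ∷ 0x036a_01 ∷ 0x0127_00 ∷ 0x014a_01 ∷ 0x0379_01 ∷ 0x038a_01 ∷ 0x02a6895_08 ∷
     0x0324_00 ∷ 0x0459_00 ∷ 0x016782459a_0b ∷ []) ∷
  coloured (11000011 ∷ 0111010 ∷ 100111 ∷ 11001 ∷ 0111 ∷ 111 ∷ 11 ∷ 0 ∷ 0 ∷ [])
    (2 ∷ 0 ∷ 1 ∷ 2 ∷ 1 ∷ 1 ∷ 0 ∷ 3 ∷ 3 ∷ [])
    (0x0258_01 ∷ 0x0478_00 ∷ 0x0679_01 ∷ 0x0145_00 ∷ 0x0326_00 ∷ 0x0678_01 ∷ 0x0237_00 ∷ 0x0349_01 ∷
     0x0279_00 ∷ 0x0279843_0a ∷ 0x0418_00 ∷ 0x0459_01 ∷ 0x0157_00 ∷ 0x0239_00 ∷ 0x0146_00 ∷ 0x0325_00 ∷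
     0x0712_00 ∷ 0x0138_01 ∷ 0x0475628_08 ∷ 0x0613_00 ∷ 0x0139_01 ∷ 0x0245_01 ∷ 0x0246_01 ∷ 0x0268_01 ∷
     0x0378_01 ∷ 0x0578_01 ∷ 0x1895604_08 ∷ 0x5601483_0a ∷ [])
    ((202022022 ∷ []) ∷ (100200112 ∷ 110100121 ∷ 000100221 ∷ 020200111 ∷ []) ∷ (022002202 ∷ 022020202 ∷
     021022201 ∷ 021000221 ∷ []) ∷ (220212100 ∷ 220221100 ∷ 222211100 ∷ []) ∷ [])
    (0x0129_00 ∷ 0x0136_00 ∷ 0x018a_01 ∷ 0x0149_00 ∷ 0x0156_00 ∷ 0x0168_01 ∷ 0x0189_01 ∷ 0x015a_01 ∷
     0x0124_00 ∷ 0x0157_00 ∷ 0x014a_01 ∷ 0x0178_01 ∷ 0x0135_00 ∷ 0x6712830_0a ∷ []) [] ∷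
  coloured (11000011 ∷ 0111010 ∷ 101101 ∷ 10110 ∷ 1101 ∷ 011 ∷ 11 ∷ 1 ∷ 0 ∷ [])
    (3 ∷ 0 ∷ 2 ∷ 3 ∷ 2 ∷ 3 ∷ 0 ∷ 2 ∷ 1 ∷ [])
    (0x0369_01 ∷ 0x0128_01 ∷ 0x0647_00 ∷ 0x0419_00 ∷ 0x0579_01 ∷ 0x0157_00 ∷ 0x0924_00 ∷ 0x0237_00 ∷
     0x0347_01 ∷ 0x0145_00 ∷ 0x0689_01 ∷ 0x0279_00 ∷ 0x0712_00 ∷ 0x0518_00 ∷ 0x0248_01 ∷ 0x0268_01 ∷
     0x0328_00 ∷ 0x0139_01 ∷ 0x0156_00 ∷ 0x0379_01 ∷ 0x0478_01 ∷ 0x0569_01 ∷ 0x0231689_08 ∷ 0x0295847_08 ∷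
     0x0495826_08 ∷ 0x2150937_08 ∷ 0x023458967_0d ∷ 0x023658749_0d ∷ [])
    ((202220020 ∷ 202112010 ∷ 202110022 ∷ 202120012 ∷ []) ∷ (222212100 ∷ 220222200 ∷ 220212120 ∷ []) ∷
     (020201201 ∷ 020202101 ∷ 220201101 ∷ []) ∷ (012020212 ∷ []) ∷ [])
    (0x0137_00 ∷ 0x019a_00 ∷ 0x0124_00 ∷ 0x018a_00 ∷ 0x0168_01 ∷ 0x017a_01 ∷ 0x0156_01 ∷ 0x0159_01 ∷
     0x014a_00 ∷ 0x018a_01 ∷ 0x0139_01 ∷ []) [] ∷
  dominated (0111100 ∷ 110011 ∷ 01110 ∷ 1101 ∷ 011 ∷ 11 ∷ 1 ∷ 0 ∷ []) 1 4
    (0x0215_00 ∷ 0x0178_00 ∷ 0x0237_01 ∷ 0x0248_01 ∷ 0x0278_01 ∷ 0x0136_01 ∷ 0x0146_01 ∷ 0x0175648_08 ∷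
     0x0185637_08 ∷ 0x012356847_0d ∷ 0x012456738_0d ∷ 0x012354768_0e ∷ 0x012453867_0e ∷ []) ∷
  coloured (1110001 ∷ 001101 ∷ 00111 ∷ 0111 ∷ 111 ∷ 10 ∷ 1 ∷ 0 ∷ []) (2 ∷ 0 ∷ 1 ∷ 1 ∷ 1 ∷ 3 ∷ 2 ∷ 3 ∷ [])
    (0x0156_00 ∷ 0x0256_01 ∷ 0x0712_00 ∷ 0x0138_01 ∷ 0x0467_01 ∷ 0x0514_00 ∷ 0x0157_00 ∷ 0x0167_00 ∷
     0x0578_01 ∷ 0x0618_00 ∷ 0x0367_01 ∷ 0x0247_00 ∷ 0x0378_01 ∷ 0x16230857_0f ∷ 0x0128_01 ∷ 0x0148_01 ∷
     0x0258_01 ∷ 0x0478_01 ∷ 0x0567_01 ∷ 0x0163487_08 ∷ 0x2163407_08 ∷ 0x1305276_09 ∷ 0x3405162_0a ∷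
     0x15083467_0f ∷ 0x16240857_0f ∷ [])
    ((10101100 ∷ 10011100 ∷ 10001010 ∷ 10101010 ∷ 10011010 ∷ 10001101 ∷ []) ∷ (11000110 ∷ 01000011 ∷
     10000111 ∷ []) ∷ (00212201 ∷ 00220202 ∷ 02210201 ∷ []) ∷ (02222020 ∷ []) ∷ [])
    (0x0139_00 ∷ 0x0189_01 ∷ 0x0167_01 ∷ 0x0178_01 ∷ 0x0123_00 ∷ 0x0159_01 ∷ 0x0168_00 ∷ 0x4506281_0a ∷
     0x327410896_0e ∷ 0x327510896_0e ∷ 0x4501973_0a ∷ 0x0923_00 ∷ 0x5620391_0a ∷ 0x0129_00 ∷ [])
    ((10000110 , 10001101 , 0 , 1) ∷ []) ∷
  coloured (1101100 ∷ 001011 ∷ 00111 ∷ 1111 ∷ 110 ∷ 01 ∷ 1 ∷ 0 ∷ []) (3 ∷ 0 ∷ 0 ∷ 0 ∷ 2 ∷ 1 ∷ 1 ∷ 2 ∷ [])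
    (0x0125_01 ∷ 0x0627_00 ∷ 0x0413_00 ∷ 0x0148_00 ∷ 0x0236_00 ∷ 0x0457_01 ∷ 0x0325_00 ∷ 0x0368_01 ∷
     0x0178_00 ∷ 0x0147_00 ∷ 0x0538_00 ∷ 0x0246_00 ∷ 0x0468_01 ∷ 0x0147628_0a ∷ 0x12067845_10 ∷ 0x0345_00 ∷
     0x0412_00 ∷ 0x0716_00 ∷ 0x0815_00 ∷ 0x0136_01 ∷ 0x0156_01 ∷ 0x0257_01 ∷ 0x0456_01 ∷ 0x0478_01 ∷
     0x0162478_04 ∷ 0x1530748_08 ∷ 0x1620847_08 ∷ 0x1204678_09 ∷ 0x15034786_10 ∷ 0x16024875_10 ∷
     0x13058746_10 ∷ [])
    ((00000222 ∷ 00002022 ∷ 20000022 ∷ []) ∷ (02220002 ∷ 20220002 ∷ 22120001 ∷ 00122001 ∷ []) ∷ (22020020 ∷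
     21220010 ∷ 21020210 ∷ []) ∷ (01121000 ∷ 01120100 ∷ 00121112 ∷ 01021121 ∷ []) ∷ [])
    (0x0167_00 ∷ 0x0123_00 ∷ 0x0127_00 ∷ 0x0136_00 ∷ 0x0147_00 ∷ 0x0189_00 ∷ 0x0149_00 ∷ 0x0136_01 ∷
     0x0138_00 ∷ 0x0149_01 ∷ 0x0138_01 ∷ 0x0147_01 ∷ 0x0167_01 ∷ 0x32187406_10 ∷ 0x42196307_10 ∷ []) [] ∷
  dominated (1100110 ∷ 010101 ∷ 01011 ∷ 1011 ∷ 101 ∷ 11 ∷ 1 ∷ 0 ∷ []) 0 7
    (0x0148_00 ∷ 0x0158_00 ∷ 0x0126_01 ∷ 0x0137_01 ∷ 0x0142768_08 ∷ 0x10364587_10 ∷ 0x10275486_10 ∷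
     0x0237_00 ∷ 0x0167_01 ∷ 0x02571368_11 ∷ []) ∷
  dominated (0001101 ∷ 101011 ∷ 00111 ∷ 1111 ∷ 011 ∷ 11 ∷ 0 ∷ 0 ∷ []) 0 3
    (0x0147_00 ∷ 0x0123_00 ∷ 0x0246_00 ∷ 0x0367_01 ∷ 0x0345_00 ∷ 0x0158_01 ∷ 0x0168_01 ∷ 0x0257_01 ∷
     0x01345786_11 ∷ 0x01246785_11 ∷ []) ∷
  coloured (1000110 ∷ 110001 ∷ 01101 ∷ 0111 ∷ 111 ∷ 10 ∷ 1 ∷ 0 ∷ []) (1 ∷ 3 ∷ 0 ∷ 1 ∷ 1 ∷ 3 ∷ 0 ∷ 2 ∷ [])
    (0x0238_01 ∷ 0x0356_01 ∷ 0x0267_00 ∷ 0x0524_00 ∷ 0x0158_00 ∷ 0x0317_00 ∷ 0x0135_00 ∷ 0x0816_00 ∷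
     0x0248_01 ∷ 0x0578_01 ∷ 0x0347_00 ∷ 0x0467_01 ∷ 0x1270835_08 ∷ 0x2340657_08 ∷ 0x2105867_09 ∷
     0x24037658_10 ∷ 0x0148_00 ∷ 0x0256_00 ∷ 0x0257_00 ∷ 0x0167_01 ∷ 0x0358_01 ∷ 0x0256817_0a ∷
     0x26340857_0f ∷ 0x23045678_10 ∷ 0x25703468_13 ∷ [])
    ((20022202 ∷ []) ∷ (02200220 ∷ []) ∷ (22022220 ∷ []) ∷ (10121000 ∷ 20220020 ∷ 10120011 ∷ []) ∷ [])
    (0x0139_00 ∷ 0x0167_00 ∷ 0x0134_00 ∷ 0x0159_00 ∷ 0x0149_00 ∷ 0x21790846_11 ∷ []) [] ∷
  coloured (1000011 ∷ 110001 ∷ 01110 ∷ 1101 ∷ 011 ∷ 11 ∷ 1 ∷ 0 ∷ []) (3 ∷ 1 ∷ 3 ∷ 0 ∷ 1 ∷ 1 ∷ 0 ∷ 2 ∷ [])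
    (0x0128_01 ∷ 0x0724_00 ∷ 0x0458_01 ∷ 0x0257_00 ∷ 0x0367_01 ∷ 0x0437_00 ∷ 0x0146_00 ∷ 0x0318_00 ∷
     0x0135_00 ∷ 0x0612_00 ∷ 0x0248_01 ∷ 0x0357_01 ∷ 0x0136_00 ∷ 0x0267_00 ∷ 0x0348_00 ∷ 0x0578_01 ∷
     0x0417_00 ∷ 0x0468_01 ∷ 0x0678_01 ∷ 0x0345678_08 ∷ 0x2435607_08 ∷ 0x1256703_09 ∷ 0x1256740_09 ∷
     0x5601382_0a ∷ 0x42560378_10 ∷ 0x42561078_10 ∷ [])
    ((20002202 ∷ 00202202 ∷ 02002101 ∷ 20202101 ∷ []) ∷ (10110010 ∷ 10210001 ∷ 20010011 ∷ 20110011 ∷ []) ∷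
     (22111000 ∷ 22110100 ∷ 01221100 ∷ 11201100 ∷ 22111100 ∷ 02001010 ∷ 01011010 ∷ 02000110 ∷ 01010110 ∷
     11211110 ∷ []) ∷ (02022020 ∷ 01001110 ∷ 01000011 ∷ []) ∷ [])
    (0x0129_00 ∷ 0x0189_00 ∷ 0x0156_01 ∷ 0x0157_01 ∷ 0x0179_00 ∷ 0x0169_00 ∷ 0x0147_00 ∷ 0x0159_00 ∷
     0x0168_01 ∷ 0x0178_01 ∷ 0x0135_00 ∷ 0x0159_01 ∷ 0x0128_00 ∷ 0x0148_00 ∷ 0x0179_01 ∷ 0x0148_01 ∷
     0x0123_01 ∷ 0x6702581_0a ∷ 0x41670598_10 ∷ 0x01549786_14 ∷ 0x10495678_11 ∷ 0x01549687_14 ∷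
     0x10495768_11 ∷ 0x13672980_10 ∷ 0x21853906_11 ∷ 0x21853907_11 ∷ 0x05941876_13 ∷ 0x05941867_13 ∷
     0x53670189_10 ∷ []) [] ∷
  dominated (1000110 ∷ 110001 ∷ 01101 ∷ 1011 ∷ 110 ∷ 11 ∷ 1 ∷ 0 ∷ []) 4 7
    (0x0528_00 ∷ 0x0356_01 ∷ 0x0267_00 ∷ 0x0457_01 ∷ 0x20463857_11 ∷ 0x0567_01 ∷ 0x20374856_11 ∷
     0x02346578_14 ∷ 0x02437568_14 ∷ []) ∷
  coloured (0110010 ∷ 100011 ∷ 01100 ∷ 1011 ∷ 101 ∷ 11 ∷ 1 ∷ 0 ∷ []) (3 ∷ 3 ∷ 0 ∷ 2 ∷ 1 ∷ 2 ∷ 1 ∷ 0 ∷ [])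
    (0x0147_01 ∷ 0x0356_01 ∷ 0x0245_00 ∷ 0x0458_01 ∷ 0x0168_00 ∷ 0x0278_01 ∷ 0x0256_00 ∷ 0x0128_00 ∷
     0x0568_01 ∷ 0x0348_00 ∷ 0x0378_00 ∷ 0x3204187_09 ∷ 0x3507248_09 ∷ 0x32574068_12 ∷ 0x13508476_14 ∷
     0x13608745_14 ∷ 0x0156_00 ∷ 0x0158_00 ∷ 0x0678_01 ∷ 0x0168345_0a ∷ 0x0347528_0a ∷ 0x31408567_14 ∷
     0x31708654_14 ∷ 0x23154780_16 ∷ [])
    ((02022220 ∷ []) ∷ (20220202 ∷ []) ∷ (22202002 ∷ []) ∷ (00222211 ∷ []) ∷ [])
    (0x0124_00 ∷ 0x0138_00 ∷ 0x0158_00 ∷ 0x0189_01 ∷ []) [] ∷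
  dominated (1110000 ∷ 001110 ∷ 01101 ∷ 1011 ∷ 001 ∷ 11 ∷ 1 ∷ 0 ∷ []) 0 4
    (0x0158_00 ∷ 0x0167_00 ∷ 0x0645_00 ∷ 0x0478_01 ∷ 0x0735_00 ∷ 0x0368_01 ∷ 0x35240768_15 ∷ 0x45230678_15 ∷
     0x15207638_17 ∷ 0x15206748_17 ∷ []) ∷
  dominated (0001110 ∷ 001101 ∷ 01011 ∷ 1011 ∷ 000 ∷ 11 ∷ 1 ∷ 0 ∷ []) 2 3
    (0x0148_00 ∷ 0x0316_00 ∷ 0x0645_00 ∷ 0x0378_01 ∷ 0x0247_00 ∷ 0x0326_00 ∷ 0x0578_00 ∷ 0x45136780_14 ∷
     0x45236870_14 ∷ 0x14560378_17 ∷ 0x24560387_17 ∷ []) ∷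
  dominated (110001 ∷ 01101 ∷ 1011 ∷ 110 ∷ 11 ∷ 1 ∷ 0 ∷ []) 3 6
    (0x0417_00 ∷ 0x0156_00 ∷ 0x0245_01 ∷ 0x0346_01 ∷ 0x0456_01 ∷ 0x10263745_11 ∷ 0x10352746_11 ∷
     0x01235467_14 ∷ 0x01326457_14 ∷ []) ∷
  coloured (001110 ∷ 01101 ∷ 1011 ∷ 001 ∷ 11 ∷ 1 ∷ 0 ∷ []) (3 ∷ 2 ∷ 3 ∷ 0 ∷ 0 ∷ 2 ∷ 1 ∷ [])
    (0x0325_00 ∷ 0x0247_01 ∷ 0x0534_00 ∷ 0x0137_00 ∷ 0x0367_01 ∷ 0x0216_00 ∷ 0x0456_00 ∷ 0x0624_00 ∷
     0x0347_01 ∷ 0x5620347_1a ∷ 0x0236_00 ∷ 0x0257_01 ∷ 0x0567_01 ∷ 0x2450367_1a ∷ 0x3460257_1a ∷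
     0x4230567_1a ∷ 0x6530247_1a ∷ 0x2451067_1a ∷ 0x01234567_18 ∷ [])
    ((2110010 ∷ 2110001 ∷ 2100011 ∷ []) ∷ (2010120 ∷ 2110100 ∷ 2001100 ∷ 2011100 ∷ 2100010 ∷ 2001010 ∷
     2111110 ∷ []) ∷ (2000202 ∷ 2020101 ∷ 2002101 ∷ []) ∷ (0202020 ∷ 0001110 ∷ 0001011 ∷ []) ∷ [])
    (0x0138_00 ∷ 0x0148_00 ∷ 0x0158_00 ∷ 0x0178_00 ∷ 0x0135_00 ∷ 0x0147_00 ∷ 0x0138_01 ∷ 0x0136_01 ∷
     0x0126_00 ∷ 0x0145_01 ∷ 0x0168_01 ∷ 0x6371048_1a ∷ 0x5341078_1a ∷ 0x1468530_1a ∷ 0x01574368_18 ∷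
     0x14735680_13 ∷ 0x01376548_18 ∷ 0x15463780_13 ∷ 0x13645780_13 ∷ 0x3561078_1a ∷ []) [] ∷
  dominated (000110 ∷ 10101 ∷ 0011 ∷ 111 ∷ 01 ∷ 1 ∷ 0 ∷ []) 0 6
    (0x0127_00 ∷ 0x0137_00 ∷ 0x0147_00 ∷ 0x5240367_1a ∷ 0x6340257_1a ∷ 0x1567230_1a ∷ 0x0564237_1b ∷ []) ∷
  coloured (11000 ∷ 0101 ∷ 011 ∷ 11 ∷ 1 ∷ 0 ∷ []) (2 ∷ 0 ∷ 1 ∷ 1 ∷ 0 ∷ 2 ∷ [])
    (0x0145_00 ∷ 0x0246_01 ∷ 0x0512_00 ∷ 0x0146_00 ∷ 0x0156_00 ∷ 0x0356_01 ∷ 0x0413_00 ∷ 0x0235_00 ∷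
     0x0324_00 ∷ 0x0456_01 ∷ 0x1230645_08 ∷ 0x1205346_09 ∷ 0x1304256_09 ∷ 0x1236450_1a ∷ 0x1450236_1c ∷ [])
    ((100101 ∷ 101101 ∷ []) ∷ (100011 ∷ 110011 ∷ []) ∷ (022200 ∷ []) ∷ (120110 ∷ 010010 ∷ 021010 ∷
     101110 ∷ []) ∷ [])
    (0x0146_00 ∷ 0x0167_01 ∷ 0x0147_00 ∷ 0x0146_01 ∷ 0x0157_01 ∷ 0x0156_01 ∷ 0x0157_00 ∷ 0x3170258_1b ∷
     0x0128_01 ∷ 0x0167_00 ∷ 0x2570146_1c ∷ 0x21347506_17 ∷ [])
    ((000001 , 101101 , 0 , 1) ∷ []) ∷
  dominated (00110 ∷ 1101 ∷ 011 ∷ 11 ∷ 1 ∷ 0 ∷ []) 0 5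
    (0x0126_00 ∷ 0x0136_00 ∷ 0x104362_1d ∷ 0x0145_01 ∷ 0x105263_1d ∷ []) ∷
  coloured (111100 ∷ 11010 ∷ 0101 ∷ 011 ∷ 11 ∷ 1 ∷ 0 ∷ []) (2 ∷ 1 ∷ 0 ∷ 3 ∷ 3 ∷ 0 ∷ 1 ∷ [])
    (0x0167_00 ∷ 0x0613_00 ∷ 0x0357_01 ∷ 0x0257_00 ∷ 0x0435_00 ∷ 0x0524_00 ∷ 0x0346_00 ∷ 0x0124_01 ∷
     0x0712_00 ∷ 0x0467_01 ∷ 0x0123_01 ∷ 0x0135_01 ∷ 0x0246_01 ∷ 0x0567_01 ∷ 0x016375_1d ∷ 0x017264_1d ∷
     0x025476_1d ∷ 0x027153_1d ∷ 0x034567_1d ∷ 0x036142_1d ∷ 0x045231_1d ∷ 0x134067_1d ∷ 0x243057_1d ∷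
     0x352046_1d ∷ 0x461035_1d ∷ 0x571024_1d ∷ 0x672013_1d ∷ 0x763012_1d ∷ [])
    ((0000000 ∷ 0100101 ∷ 1100101 ∷ 0101101 ∷ []) ∷ (1010010 ∷ 0011010 ∷ 1011010 ∷ []) ∷ (0101100 ∷ 0011100 ∷
     0111100 ∷ []) ∷ (1000011 ∷ 1100011 ∷ 1010011 ∷ []) ∷ [])
    (0x0168_00 ∷ 0x0157_01 ∷ 0x0178_00 ∷ 0x0157_00 ∷ 0x0124_00 ∷ 0x0146_00 ∷ 0x0178_01 ∷ 0x0168_01 ∷
     0x0129_01 ∷ 0x0625_00 ∷ 0x96502871_12 ∷ [])
    ((0011110 , 1010010 , 1 , 2) ∷ (1100001 , 1010011 , 3 , 0) ∷ []) ∷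
  coloured (0101 ∷ 011 ∷ 11 ∷ 1 ∷ 0 ∷ []) (0 ∷ 1 ∷ 3 ∷ 0 ∷ 2 ∷ [])
    (0x0124_00 ∷ 0x0245_01 ∷ 0x0213_00 ∷ 0x0135_01 ∷ 0x0345_01 ∷ 0x012345_1d ∷ 0x102354_1e ∷ 0x201453_1e ∷ [])
    ((00100 ∷ 01100 ∷ 01101 ∷ []) ∷ (00000 ∷ 00001 ∷ 00011 ∷ []) ∷ (11100 ∷ 02010 ∷ 11010 ∷ 00110 ∷
     11110 ∷ []) ∷ (10010 ∷ 11001 ∷ 10011 ∷ []) ∷ [])
    (0x0146_00 ∷ 0x0126_00 ∷ 0x0124_00 ∷ 0x0135_00 ∷ 0x0146_01 ∷ 0x0124_01 ∷ 0x0126_01 ∷ 0x0135_01 ∷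
     0x0145_01 ∷ 0x320571_1e ∷ 0x135046_1e ∷ 0x213460_1e ∷ 0x214067_1d ∷ 0x015264_1d ∷ 0x0132546_1f ∷
     0x3021564_1b ∷ 0x126054_1e ∷ 0x2031465_1b ∷ 0x1345026_1b ∷ 0x312560_1e ∷ [])
    ((00101 , 01100 , 0 , 1) ∷ []) ∷
  coloured (11 ∷ 1 ∷ 0 ∷ []) (2 ∷ 1 ∷ 0 ∷ [])
    (0x0123_01 ∷ [])
    ((100 ∷ 110 ∷ []) ∷ (001 ∷ 101 ∷ []) ∷ (010 ∷ 011 ∷ []) ∷ (200 ∷ []) ∷ [])
    (0x0134_00 ∷ 0x14032_20 ∷ 0x0123_01 ∷ 0x0123_00 ∷ 0x13024_20 ∷ 0x0124_01 ∷ 0x0124_00 ∷ 0x12043_20 ∷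
     0x0134_01 ∷ []) [] ∷
  coloured (1 ∷ 0 ∷ []) (2 ∷ 1 ∷ [])
    (0x012_21 ∷ [])
    ((00 ∷ []) ∷ (10 ∷ []) ∷ (01 ∷ []) ∷ [])
    (0x0123_00 ∷ 0x012_21 ∷ 0x013_21 ∷ []) [] ∷
  coloured [] []
    []
    ((0 ∷ []) ∷ [])
    (0x01_22 ∷ []) [] ∷
  []

2K₂-K₅-e-K₆-steps : List Step
2K₂-K₅-e-K₆-steps =
  coloured (00001101 ∷ 0101011 ∷ 010111 ∷ 10111 ∷ 1011 ∷ 111 ∷ 11 ∷ 0 ∷ 0 ∷ [])
    (3 ∷ 1 ∷ 0 ∷ 0 ∷ 1 ∷ 0 ∷ 1 ∷ 3 ∷ 2 ∷ [])
    (0x0124_00 ∷ 0x25049_01 ∷ 0x36078_01 ∷ 0x0316_00 ∷ 0x0128_00 ∷ 0x01679_01 ∷ 0x0148_00 ∷ 0x0517_00 ∷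
     0x06179_01 ∷ 0x07169_01 ∷ 0x57068_01 ∷ 0x0217_00 ∷ 0x0416_00 ∷ 0x09167_01 ∷ 0x0135_00 ∷ 0x0158_00 ∷
     0x0326_00 ∷ 0x0819_00 ∷ 0x0145_00 ∷ 0x0237_00 ∷ 0x89024_01 ∷ 0x89035_01 ∷ 0x89045_01 ∷ [])
    ((020020222 ∷ []) ∷ (002202022 ∷ []) ∷ (222222020 ∷ []) ∷ (022222200 ∷ []) ∷ (222220220 ∷ []) ∷ [])
    (0x0127_00 ∷ 0x0128_00 ∷ 0x018a_00 ∷ 0x012a_00 ∷ 0x017a_00 ∷ []) [] ∷
  coloured (101100011 ∷ 00011101 ∷ 1111001 ∷ 110110 ∷ 01101 ∷ 0111 ∷ 111 ∷ 10 ∷ 1 ∷ 0 ∷ [])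
    (0 ∷ 4 ∷ 3 ∷ 4 ∷ 1 ∷ 0 ∷ 0 ∷ 3 ∷ 1 ∷ 2 ∷ [])
    (0x0328_00 ∷ 0x8a057_01 ∷ 0x083a_00 ∷ 0x0735a_01 ∷ 0x0a357_01 ∷ 0x0935_00 ∷ 0x0427_00 ∷ 0x2307a_01 ∷
     0x0234_00 ∷ 0x0657_00 ∷ 0x08469_01 ∷ 0x0537a_01 ∷ 0x0168_00 ∷ 0x24068_01 ∷ 0x0245_00 ∷ 0x0a48_00 ∷
     0x042a_00 ∷ 0x04689_01 ∷ 0x0178_00 ∷ 0x0526_00 ∷ 0x06489_01 ∷ 0x0569_00 ∷ 0x0249_00 ∷ 0x0312_00 ∷
     0x0319_00 ∷ 0x0389_00 ∷ 0x0714_00 ∷ 0x0746_00 ∷ 0x0357a_01 ∷ 0x09468_01 ∷ [])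
    ((0220200022 ∷ 0200000222 ∷ 0222000022 ∷ 0202200022 ∷ []) ∷ (2202002202 ∷ 2220002202 ∷ 2122001102 ∷
     1122002201 ∷ 1000021101 ∷ []) ∷ (2222200220 ∷ 0222202220 ∷ 0222220220 ∷ []) ∷ (2202222002 ∷ []) ∷
     (2020220220 ∷ 2020022200 ∷ 1000222210 ∷ 2000220202 ∷ 1020020211 ∷ []) ∷ [])
    (0x017a_00 ∷ 0x0156_00 ∷ 0x0179_00 ∷ 0x0138_00 ∷ 0x013b_00 ∷ 0x015a_00 ∷ 0x0145_00 ∷ 0x018b_00 ∷
     0x0146_00 ∷ 0x0147_00 ∷ 0x017b_00 ∷ 0x0125_00 ∷ 0x0126_00 ∷ 0x012b_00 ∷ 0x03189_01 ∷ 0x0312b_01 ∷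
     0x019a_00 ∷ 0x1b02a_01 ∷ []) [] ∷
  coloured (011110010 ∷ 11101100 ∷ 1011001 ∷ 000111 ∷ 11101 ∷ 1110 ∷ 011 ∷ 11 ∷ 1 ∷ 0 ∷ [])
    (3 ∷ 4 ∷ 1 ∷ 2 ∷ 1 ∷ 2 ∷ 0 ∷ 0 ∷ 1 ∷ 4 ∷ [])
    (0x0456_00 ∷ 0x0837_00 ∷ 0x0389_00 ∷ 0x38024_01 ∷ 0x0127_00 ∷ 0x7805a_01 ∷ 0x0849a_01 ∷ 0x029a_00 ∷
     0x018a_00 ∷ 0x0a489_01 ∷ 0x0a16_00 ∷ 0x0748_00 ∷ 0x6a089_01 ∷ 0x064a_00 ∷ 0x0219_00 ∷ 0x0358_00 ∷
     0x0269_00 ∷ 0x0216_00 ∷ 0x0624_00 ∷ 0x0489a_01 ∷ 0x0948a_01 ∷ 0x6a057_01 ∷ 0x0457_00 ∷ 0x26037_01 ∷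
     0x78025_01 ∷ 0x72196408a3_04 ∷ 0x0128_00 ∷ 0x017a_00 ∷ [])
    ((2120120021 ∷ 2200220022 ∷ 2102120021 ∷ []) ∷ (2002011000 ∷ 1002011202 ∷ 2002011201 ∷ 1202011001 ∷
     1102011101 ∷ []) ∷ (2020002222 ∷ 2220002220 ∷ 2020202220 ∷ []) ∷ (0202222020 ∷ 0022222020 ∷ 0121110010 ∷
     0001110001 ∷ []) ∷ (2022222200 ∷ []) ∷ [])
    (0x0134_00 ∷ 0x019b_00 ∷ 0x28017_01 ∷ 0x7b018_01 ∷ 0x0148_00 ∷ 0x0139_00 ∷ 0x0159_00 ∷ 0x0135_00 ∷
     0x3b016_01 ∷ 0x0167_00 ∷ 0x0169_00 ∷ 0x015b_00 ∷ 0x0124_00 ∷ 0x01ab_00 ∷ 0x13a6b0798_03 ∷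
     0x38051b7a96_04 ∷ []) [] ∷
  coloured (00011110 ∷ 0101101 ∷ 001111 ∷ 11110 ∷ 1011 ∷ 001 ∷ 11 ∷ 1 ∷ 0 ∷ [])
    (0 ∷ 4 ∷ 2 ∷ 0 ∷ 2 ∷ 1 ∷ 1 ∷ 4 ∷ 0 ∷ [])
    (0x0756_00 ∷ 0x0324_00 ∷ 0x0537_00 ∷ 0x57048_01 ∷ 0x0218_00 ∷ 0x0139_00 ∷ 0x0315_00 ∷ 0x03789_01 ∷
     0x07389_01 ∷ 0x14056_01 ∷ 0x09378_01 ∷ 0x0258_00 ∷ 0x0129_00 ∷ 0x08379_01 ∷ 0x0124_00 ∷ 0x0238_00 ∷
     0x0345_00 ∷ 0x0439_00 ∷ 0x0527_00 ∷ 0x0678_00 ∷ 0x13078_01 ∷ 0x14058_01 ∷ 0x23079_01 ∷ 0x25046_01 ∷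
     0x68015_01 ∷ [])
    ((020022220 ∷ []) ∷ (222220002 ∷ []) ∷ (220202022 ∷ []) ∷ (211010010 ∷ 111210100 ∷ 201110100 ∷ 111011100 ∷
     211100010 ∷ 011210010 ∷ 111101010 ∷ 011011010 ∷ []) ∷ (000222202 ∷ 002111202 ∷ 200110202 ∷
     200101202 ∷ []) ∷ [])
    (0x017a_00 ∷ 0x018a_00 ∷ 0x0149_00 ∷ 0x019a_00 ∷ 0x34017_01 ∷ 0x0129_00 ∷ 0x014a_00 ∷ 0x0189_00 ∷
     0x0148_00 ∷ 0x156930784a_05 ∷ 0x637a120894_05 ∷ 0x2318760a94_05 ∷ 0x613a780495_04 ∷ 0x31580764a9_05 ∷
     0x60591734a8_05 ∷ 0x0329687a41_04 ∷ 0x07156_01 ∷ 0x06157_01 ∷ []) [] ∷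
  coloured (111111000 ∷ 11100110 ∷ 1010011 ∷ 001101 ∷ 11101 ∷ 1110 ∷ 011 ∷ 11 ∷ 1 ∷ 0 ∷ [])
    (3 ∷ 0 ∷ 1 ∷ 2 ∷ 4 ∷ 0 ∷ 1 ∷ 1 ∷ 2 ∷ 0 ∷ [])
    (0x0189_00 ∷ 0x0267_00 ∷ 0x18056_01 ∷ 0x5907a_01 ∷ 0x0813_00 ∷ 0x018a_00 ∷ 0x0469_00 ∷ 0x18024_01 ∷
     0x01234_01 ∷ 0x0a12_00 ∷ 0x06157_01 ∷ 0x064a_00 ∷ 0x0534_00 ∷ 0x0915_00 ∷ 0x04123_01 ∷ 0x01567_01 ∷
     0x02134_01 ∷ 0x03124_01 ∷ 0x05167_01 ∷ 0x0358_00 ∷ 0x0817_00 ∷ 0x07156_01 ∷ 0x2a089_01 ∷ 0x5908a_01 ∷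
     0x0539_00 ∷ 0x0914_00 ∷ 0x037289156_06 ∷ 0x04539a167_06 ∷ 0x0627a9143_06 ∷ 0x07358a124_06 ∷
     0x08357a214_06 ∷ 0x087239516_06 ∷ 0x094658312_06 ∷ 0x0a6428715_06 ∷ 0x8103964a7_06 ∷ 0x3021a98765_05 ∷
     0x40318a9576_05 ∷ [])
    ((0022200220 ∷ 0020202220 ∷ 2020000110 ∷ 0021101110 ∷ []) ∷ (0202020022 ∷ 0002220022 ∷ 2002000011 ∷
     0102110011 ∷ []) ∷ (0220202202 ∷ 0220220202 ∷ 0200222202 ∷ 2200000101 ∷ 0210011101 ∷ []) ∷
     (0222222020 ∷ []) ∷ (2022022222 ∷ []) ∷ [])
    (0x0125_00 ∷ 0x0128_00 ∷ 0x0123_00 ∷ 0x0178_00 ∷ 0x0168_00 ∷ 0x0158_00 ∷ 0x0135_00 ∷ 0x0136_00 ∷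
     0x0134_00 ∷ 0x017a_00 ∷ 0x0145_00 ∷ 0x157b60a89_03 ∷ 0x138970b6a_03 ∷ 0x146a8097b_03 ∷
     0x019b_00 ∷ []) [] ∷
  coloured (00101101 ∷ 0100111 ∷ 010111 ∷ 10011 ∷ 1011 ∷ 111 ∷ 11 ∷ 0 ∷ 0 ∷ [])
    (3 ∷ 1 ∷ 0 ∷ 0 ∷ 1 ∷ 0 ∷ 4 ∷ 3 ∷ 2 ∷ [])
    (0x0745_00 ∷ 0x0128_00 ∷ 0x0819_00 ∷ 0x89056_01 ∷ 0x0135_00 ∷ 0x09167_01 ∷ 0x07169_01 ∷ 0x0527_00 ∷
     0x01679_01 ∷ 0x25048_01 ∷ 0x0216_00 ∷ 0x0138_00 ∷ 0x0256_00 ∷ 0x0324_00 ∷ 0x06179_01 ∷ 0x0158_00 ∷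
     0x0235_00 ∷ 0x0314_00 ∷ 0x0316_00 ∷ 0x57038_01 ∷ 0x0437_00 ∷ 0x0467_00 ∷ 0x0624_00 ∷ 0x13079_01 ∷
     0x89024_01 ∷ 0x89035_01 ∷ 0x89045_01 ∷ 0x051824679_06 ∷ 0x312659084_06 ∷ [])
    ((200020020 ∷ 100020110 ∷ 210020110 ∷ 110010011 ∷ 200010111 ∷ []) ∷ (002101100 ∷ 101101010 ∷ 201200110 ∷
     202200002 ∷ 001101011 ∷ 000100111 ∷ []) ∷ (222220020 ∷ 121011000 ∷ 112111000 ∷ 112010100 ∷ 111110100 ∷
     112001010 ∷ 112011010 ∷ 100110110 ∷ []) ∷ (000210101 ∷ 020222200 ∷ 002222200 ∷ 021111100 ∷
     000100101 ∷ []) ∷ (022222002 ∷ 222220002 ∷ 022220022 ∷ []) ∷ [])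
    (0x017a_00 ∷ 0x018a_00 ∷ 0x015a_00 ∷ 0x013a_00 ∷ 0x0139_00 ∷ 0x0178_00 ∷ 0x012a_00 ∷ 0x0138_00 ∷
     0x0167_00 ∷ 0x0189_00 ∷ 0x0135_00 ∷ 0x26015_01 ∷ 0x0149_00 ∷ 0x0128_00 ∷ 0x9a016_01 ∷ 0x9a015_01 ∷
     0x5170392a8_06 ∷ 0x08139_01 ∷ 0x03189_01 ∷ 0x13290587a_06 ∷ 0x16290578a_06 ∷ 0x42076a195_06 ∷
     0x08149_01 ∷ 0x59120748a6_04 ∷ 0x14520a9876_04 ∷ 0x093861572a_05 ∷ 0x60971532a8_05 ∷ 0x709628a135_07 ∷
     0x316a570289_04 ∷ 0x07169_01 ∷ 0x291407a68_03 ∷ 0x90216587a_06 ∷ []) [] ∷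
  coloured (0011101 ∷ 011011 ∷ 10111 ∷ 1001 ∷ 110 ∷ 11 ∷ 1 ∷ 0 ∷ []) (1 ∷ 4 ∷ 2 ∷ 0 ∷ 2 ∷ 0 ∷ 1 ∷ 3 ∷ [])
    (0x0315_00 ∷ 0x0624_00 ∷ 0x0467_00 ∷ 0x0236_00 ∷ 0x06378_01 ∷ 0x0137_00 ∷ 0x0714_00 ∷ 0x07368_01 ∷
     0x08367_01 ∷ 0x03678_01 ∷ 0x0325_00 ∷ 0x46015_01 ∷ 0x47025_01 ∷ 0x0538_00 ∷ 0x13068_01 ∷ 0x35067_01 ∷
     0x013524678_06 ∷ 0x023514768_06 ∷ 0x310427658_08 ∷ 0x320416758_08 ∷ [])
    ((22202002 ∷ []) ∷ (02010101 ∷ 02111100 ∷ 02022200 ∷ 02011102 ∷ []) ∷ (00020220 ∷ 22000220 ∷ 11010110 ∷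
     01000101 ∷ 10000011 ∷ []) ∷ (11100100 ∷ 11110100 ∷ 01101100 ∷ 11101100 ∷ 11100010 ∷ 11110010 ∷ 10101010 ∷
     11101010 ∷ []) ∷ (20010011 ∷ 20111010 ∷ 20022020 ∷ 20011012 ∷ []) ∷ [])
    (0x0159_00 ∷ 0x0189_00 ∷ 0x0179_00 ∷ 0x0149_00 ∷ 0x0148_00 ∷ 0x0147_00 ∷ 0x0145_00 ∷ 0x0126_00 ∷
     0x0136_00 ∷ 0x23015_01 ∷ 0x57016_01 ∷ 0x58016_01 ∷ 0x0178_00 ∷ 0x821604957_08 ∷ 0x420538719_08 ∷
     0x430527819_08 ∷ 0x1627305849_05 ∷ 0x0638215749_05 ∷ 0x3068152497_05 ∷ 0x8063479125_07 ∷
     0x2167053498_05 ∷ 0x7162489035_07 ∷ 0x731604958_08 ∷ []) [] ∷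
  coloured (0001101 ∷ 101110 ∷ 01011 ∷ 1111 ∷ 001 ∷ 11 ∷ 1 ∷ 0 ∷ []) (3 ∷ 4 ∷ 1 ∷ 1 ∷ 0 ∷ 0 ∷ 3 ∷ 2 ∷ [])
    (0x0423_00 ∷ 0x0248_00 ∷ 0x04678_01 ∷ 0x24067_01 ∷ 0x0567_00 ∷ 0x06478_01 ∷ 0x07468_01 ∷ 0x0147_00 ∷
     0x0346_00 ∷ 0x0218_00 ∷ 0x08467_01 ∷ 0x34078_01 ∷ 0x0127_00 ∷ 0x0137_00 ∷ 0x28035_01 ∷ 0x57023_01 ∷
     0x03452678_09 ∷ 0x03625487_09 ∷ [])
    ((22020002 ∷ 22220000 ∷ 21010010 ∷ 21110001 ∷ []) ∷ (22002022 ∷ []) ∷ (21112100 ∷ 22111100 ∷ 20110010 ∷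
     21110010 ∷ 20111010 ∷ []) ∷ (00202202 ∷ 00220202 ∷ 02200202 ∷ []) ∷ (20202220 ∷ []) ∷ [])
    (0x0179_00 ∷ 0x0178_00 ∷ 0x0189_00 ∷ 0x0138_00 ∷ 0x0158_00 ∷ 0x0146_00 ∷ 0x45016_01 ∷ 0x0126_00 ∷
     0x03941578_09 ∷ 0x06714895_09 ∷ 0x617043598_06 ∷ 0x0157_00 ∷ 0x18034_01 ∷ 0x0159_00 ∷ []) [] ∷
  coloured (0111100 ∷ 111010 ∷ 10101 ∷ 0011 ∷ 111 ∷ 11 ∷ 1 ∷ 0 ∷ []) (2 ∷ 3 ∷ 1 ∷ 0 ∷ 0 ∷ 3 ∷ 1 ∷ 2 ∷ [])
    (0x0534_00 ∷ 0x0624_00 ∷ 0x0713_00 ∷ 0x37048_01 ∷ 0x0178_00 ∷ 0x07568_01 ∷ 0x0357_00 ∷ 0x06578_01 ∷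
     0x17056_01 ∷ 0x05678_01 ∷ 0x0268_00 ∷ 0x0456_00 ∷ 0x26057_01 ∷ 0x03514786_09 ∷ 0x04523687_09 ∷
     0x03741568_09 ∷ 0x04632578_09 ∷ 0x01374568_0a ∷ 0x02463578_0a ∷ 0x03452687_0a ∷ [])
    ((22200022 ∷ []) ∷ (22020202 ∷ []) ∷ (02222200 ∷ []) ∷ (20222020 ∷ []) ∷ (22112210 ∷ 22112001 ∷ []) ∷ [])
    (0x0167_00 ∷ 0x0168_00 ∷ 0x0189_00 ∷ 0x0179_00 ∷ 0x48015_01 ∷ 0x19045_01 ∷ 0x0178_00 ∷ []) [] ∷
  coloured (111010 ∷ 10101 ∷ 0011 ∷ 111 ∷ 11 ∷ 1 ∷ 0 ∷ []) (0 ∷ 2 ∷ 1 ∷ 2 ∷ 0 ∷ 4 ∷ 3 ∷ [])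
    (0x0513_00 ∷ 0x0157_00 ∷ 0x05467_01 ∷ 0x15046_01 ∷ 0x0345_00 ∷ 0x0246_00 ∷ 0x04567_01 ∷ 0x06457_01 ∷
     0x0423_00 ∷ 0x07456_01 ∷ 0x26013_01 ∷ 0x34067_01 ∷ 0x03412576_09 ∷ 0x02341576_0a ∷ 0x02135476_0b ∷ [])
    ((0000000 ∷ 0101000 ∷ 0011000 ∷ 0000010 ∷ 0100010 ∷ 0101010 ∷ 0011010 ∷ 0111010 ∷ []) ∷ (1101100 ∷
     0000001 ∷ 1000001 ∷ 1000011 ∷ 0100011 ∷ 1100011 ∷ []) ∷ (2020202 ∷ []) ∷ (2010110 ∷ 0011100 ∷ 2111100 ∷
     0110110 ∷ []) ∷ (2222002 ∷ []) ∷ [])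
    (0x0168_00 ∷ 0x0156_00 ∷ 0x0124_00 ∷ 0x0167_00 ∷ 0x0123_00 ∷ 0x0147_00 ∷ 0x0138_00 ∷ 0x0178_00 ∷
     0x0158_00 ∷ 0x0157_00 ∷ 0x46013_01 ∷ 0x03218765_0b ∷ 0x02317856_0b ∷ 0x45608213_0a ∷ 0x0725_00 ∷
     0x14209876_0b ∷ 0x13504786_09 ∷ 0x21084567_0a ∷ [])
    ((0000011 , 0111010 , 0 , 1) ∷ []) ∷
  coloured (10101 ∷ 0011 ∷ 111 ∷ 11 ∷ 1 ∷ 0 ∷ []) (2 ∷ 0 ∷ 2 ∷ 1 ∷ 4 ∷ 3 ∷ [])
    (0x0312_00 ∷ 0x0135_00 ∷ 0x03456_01 ∷ 0x13046_01 ∷ 0x0234_00 ∷ 0x04356_01 ∷ 0x06345_01 ∷ 0x05346_01 ∷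
     0x23056_01 ∷ 0x0123456_0c ∷ 0x0213546_0c ∷ [])
    ((000000 ∷ 101100 ∷ 000010 ∷ 100010 ∷ 101010 ∷ 100110 ∷ []) ∷ (011010 ∷ 000001 ∷ 011001 ∷ 000011 ∷ []) ∷
     (020202 ∷ []) ∷ (020220 ∷ 011100 ∷ 210110 ∷ []) ∷ (222002 ∷ []) ∷ [])
    (0x0137_00 ∷ 0x0125_00 ∷ 0x0145_00 ∷ 0x0147_00 ∷ 0x0156_00 ∷ 0x0127_00 ∷ 0x0146_00 ∷ 0x0426_00 ∷
     0x1024657_0c ∷ 0x1204567_0c ∷ 0x3482017_0c ∷ 0x2016578_0c ∷ 0x1304756_0c ∷ [])
    ((100011 , 100110 , 0 , 1) ∷ []) ∷
  coloured (111 ∷ 11 ∷ 1 ∷ 0 ∷ []) (3 ∷ 4 ∷ 1 ∷ 2 ∷ [])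
    (0x01234_01 ∷ 0x02134_01 ∷ 0x03124_01 ∷ 0x04123_01 ∷ [])
    ((1001 ∷ 0101 ∷ 0011 ∷ 1111 ∷ []) ∷ (2200 ∷ []) ∷ (0020 ∷ 1010 ∷ 0110 ∷ []) ∷ (0202 ∷ []) ∷ [])
    (0x0125_00 ∷ 0x0135_00 ∷ 0x0124_00 ∷ 0x0123_00 ∷ 0x0134_00 ∷ 0x104235_0d ∷ 0x103245_0d ∷ 0x13025_01 ∷
     0x102345_0d ∷ 0x12035_01 ∷ 0x12045_01 ∷ 0x012345_02 ∷ 0x0145_00 ∷ 0x105234_0d ∷ []) [] ∷
  []

3K₂-K₃-steps : List Step
3K₂-K₃-steps =
  coloured (1000010000 ∷ 000001000 ∷ 10000100 ∷ 0000010 ∷ 011000 ∷ 00110 ∷ 0001 ∷ 001 ∷ 01 ∷ 1 ∷ 0 ∷ [])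
    (0 ∷ 1 ∷ 0 ∷ 2 ∷ 0 ∷ 0 ∷ 1 ∷ 3 ∷ 2 ∷ 3 ∷ 0 ∷ [])
    (0x028_01 ∷ 0x04a_01 ∷ 0x017_01 ∷ 0x039_01 ∷ 0x051234_00 ∷ 0x069_01 ∷ 0x08b_01 ∷ 0x04129b_00 ∷ 0x0ab_01 ∷
     0x02347b_00 ∷ 0x061234_00 ∷ 0x057_01 ∷ 0x081734_00 ∷ 0x0a3958_00 ∷ 0x0b1234_00 ∷ 0x05126a_00 ∷
     0x063458_00 ∷ 0x08176a_00 ∷ 0x0a1239_00 ∷ [])
    ((00000020200 ∷ 02000010200 ∷ 00000012200 ∷ 00020020100 ∷ 02020010100 ∷ 00020012100 ∷ 00000020120 ∷
     02000010120 ∷ 00000012120 ∷ []) ∷ (10222202222 ∷ []) ∷ (22102222022 ∷ []) ∷ (21212220202 ∷ 21222220201 ∷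
     22212220201 ∷ []) ∷ [])
    (0x018_01 ∷ 0x01a_01 ∷ 0x012345_00 ∷ 0x01697b_00 ∷ 0x01237b_00 ∷ 0x014569_00 ∷ 0x013_01 ∷ 0x015_01 ∷
     0x01c_01 ∷ 0x012_01 ∷ 0x014_01 ∷ []) [] ∷
  coloured (110000000 ∷ 01000000 ∷ 0100000 ∷ 100000 ∷ 00000 ∷ 1100 ∷ 010 ∷ 01 ∷ 1 ∷ 0 ∷ [])
    (1 ∷ 0 ∷ 0 ∷ 1 ∷ 2 ∷ 1 ∷ 0 ∷ 0 ∷ 1 ∷ 2 ∷ [])
    (0x012_01 ∷ 0x035_01 ∷ 0x067_01 ∷ 0x08a_01 ∷ 0x024_01 ∷ 0x079_01 ∷ 0x013_01 ∷ 0x045_01 ∷ 0x068_01 ∷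
     0x09a_01 ∷ 0x051267_00 ∷ 0x0a3567_00 ∷ 0x06129a_00 ∷ 0x07128a_00 ∷ 0x014567_00 ∷ 0x023567_00 ∷
     0x014568_00 ∷ 0x023579_00 ∷ 0x032468_00 ∷ 0x01459a_00 ∷ 0x02358a_00 ∷ 0x032479_00 ∷ 0x03248a_00 ∷
     0x03249a_00 ∷ 0x041368_00 ∷ 0x041379_00 ∷ 0x04138a_00 ∷ 0x04139a_00 ∷ 0x051268_00 ∷ 0x051279_00 ∷
     0x05128a_00 ∷ 0x05129a_00 ∷ 0x06139a_00 ∷ 0x06459a_00 ∷ 0x07248a_00 ∷ 0x07358a_00 ∷ 0x081379_00 ∷
     0x082479_00 ∷ 0x083579_00 ∷ 0x084579_00 ∷ 0x091368_00 ∷ 0x092468_00 ∷ 0x093568_00 ∷ 0x094568_00 ∷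
     0x0a1267_00 ∷ 0x0a1367_00 ∷ 0x0a2467_00 ∷ 0x0a4567_00 ∷ 0x126859347a0_02 ∷ 0x127958346a0_02 ∷
     0x128a5734690_02 ∷ 0x129a5634780_02 ∷ 0x13674a25890_02 ∷ 0x136849257a0_02 ∷ 0x137948256a0_02 ∷
     0x138a4725690_02 ∷ 0x139a4625780_02 ∷ 0x24673a15890_02 ∷ 0x246839157a0_02 ∷ 0x247938156a0_02 ∷
     0x248a3715690_02 ∷ 0x249a3615780_02 ∷ 0x35672a14890_02 ∷ 0x356829147a0_02 ∷ 0x357928146a0_02 ∷
     0x358a2714690_02 ∷ 0x359a2614780_02 ∷ 0x45671a23890_02 ∷ 0x456819237a0_02 ∷ 0x457918236a0_02 ∷
     0x458a1723690_02 ∷ 0x459a1623780_02 ∷ [])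
    ((2000020000 ∷ 1002020000 ∷ 1000220000 ∷ 2000010020 ∷ 2000010002 ∷ []) ∷ (0120002000 ∷ 0100202000 ∷
     0200001200 ∷ 0200001002 ∷ []) ∷ (0022000220 ∷ []) ∷ [])
    (0x01358a_00 ∷ 0x01469b_00 ∷ 0x01359b_00 ∷ 0x01468a_00 ∷ 0x0156ab_00 ∷ 0x012479_00 ∷ 0x012_01 ∷ 0x017_01 ∷
     0x015679_00 ∷ 0x013_01 ∷ 0x0124ab_00 ∷ 0x018_01 ∷ 0x012378_00 ∷ []) [] ∷
  coloured (100100000 ∷ 10000000 ∷ 1000001 ∷ 100000 ∷ 00001 ∷ 1001 ∷ 100 ∷ 10 ∷ 1 ∷ 0 ∷ [])
    (3 ∷ 0 ∷ 3 ∷ 0 ∷ 2 ∷ 1 ∷ 0 ∷ 1 ∷ 2 ∷ 0 ∷ [])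
    (0x015_01 ∷ 0x089_01 ∷ 0x034_01 ∷ 0x067_01 ∷ 0x023_01 ∷ 0x0a1278_00 ∷ 0x013a78_00 ∷ 0x078_01 ∷ 0x06a_01 ∷
     0x041267_00 ∷ 0x052378_00 ∷ 0x094567_00 ∷ 0x04129a_00 ∷ 0x05a_01 ∷ 0x09a_01 ∷ 0x08126a_00 ∷ 0x041278_00 ∷
     0x061289_00 ∷ 0x091267_00 ∷ 0x0697812534_03 ∷ [])
    ((0020210100 ∷ 0010220200 ∷ 0020000000 ∷ 2010000120 ∷ 2010010020 ∷ 0010210020 ∷ []) ∷ (2222201022 ∷ []) ∷
     (1222022102 ∷ 1220000202 ∷ 1222022201 ∷ 2220000101 ∷ []) ∷ (0102222222 ∷ []) ∷ [])
    (0x014_01 ∷ 0x012_01 ∷ 0x0123ab_00 ∷ 0x019_01 ∷ 0x017_01 ∷ 0x015678_00 ∷ 0x012389_00 ∷ 0x015689_00 ∷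
     0x01b_01 ∷ 0x018_01 ∷ 0x013_01 ∷ []) [] ∷
  dominated (10010000 ∷ 1000000 ∷ 100000 ∷ 10000 ∷ 0000 ∷ 100 ∷ 10 ∷ 1 ∷ 0 ∷ []) 5 7
    (0x067_01 ∷ 0x012_01 ∷ 0x034_01 ∷ 0x052378_00 ∷ 0x061589_00 ∷ 0x023_01 ∷ 0x015_01 ∷ 0x045_01 ∷
     0x013478_00 ∷ 0x024578_00 ∷ 0x031578_00 ∷ 0x041278_00 ∷ 0x061289_00 ∷ 0x062389_00 ∷ 0x063489_00 ∷
     0x064589_00 ∷ 0x0697812534_03 ∷ 0x1234567890_04 ∷ 0x1543267890_04 ∷ 0x2345167890_04 ∷ 0x3451267890_04 ∷
     0x4512367890_04 ∷ []) ∷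
  coloured (010000101 ∷ 10010001 ∷ 1000000 ∷ 100001 ∷ 10000 ∷ 0000 ∷ 101 ∷ 10 ∷ 0 ∷ 0 ∷ [])
    (0 ∷ 3 ∷ 1 ∷ 2 ∷ 0 ∷ 1 ∷ 0 ∷ 1 ∷ 0 ∷ 1 ∷ [])
    (0x045_01 ∷ 0x018_01 ∷ 0x026_01 ∷ 0x04a_01 ∷ 0x071356_00 ∷ 0x09567a_00 ∷ 0x01a_01 ∷ 0x035689_00 ∷
     0x078_01 ∷ 0x02a_01 ∷ 0x024589_00 ∷ 0x042689_00 ∷ 0x089_01 ∷ 0x013_01 ∷ 0x07a_01 ∷ 0x035678_00 ∷
     0x03567a_00 ∷ 0x091356_00 ∷ 0x091a56_00 ∷ 0x0a5689_00 ∷ 0x234560789_05 ∷ [])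
    ((0000000100 ∷ 0100000100 ∷ 0001000100 ∷ 0101000100 ∷ 0000000101 ∷ 0010000101 ∷ []) ∷ (1000000000 ∷
     1101000000 ∷ 1100100000 ∷ 1101001000 ∷ 0100101000 ∷ 1100101000 ∷ 0100100010 ∷ 1100100010 ∷ 1000001010 ∷
     1100001010 ∷ 1001001010 ∷ 1101001010 ∷ []) ∷ (2220122222 ∷ []) ∷ (2022212222 ∷ []) ∷ [])
    (0x012_01 ∷ 0x013_01 ∷ 0x012467_00 ∷ 0x018_01 ∷ 0x016_01 ∷ 0x019_01 ∷ 0x01a_01 ∷ 0x014_01 ∷ 0x01459a_00 ∷
     0x014589_00 ∷ 0x092578_00 ∷ 0x01569a_00 ∷ 0x0156ab_00 ∷ 0x01789a_00 ∷ 0x017_01 ∷ [])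
    ((0000000000 , 0010000101 , 0 , 1) ∷ (0101000000 , 0010000101 , 0 , 1) ∷ []) ∷
  coloured (10010001 ∷ 1000000 ∷ 100001 ∷ 10000 ∷ 0000 ∷ 101 ∷ 10 ∷ 0 ∷ 0 ∷ [])
    (2 ∷ 0 ∷ 1 ∷ 0 ∷ 1 ∷ 0 ∷ 3 ∷ 0 ∷ 3 ∷ [])
    (0x015_01 ∷ 0x039_01 ∷ 0x067_01 ∷ 0x034_01 ∷ 0x084569_00 ∷ 0x019_01 ∷ 0x069_01 ∷ 0x024567_00 ∷ 0x078_01 ∷
     0x024569_00 ∷ 0x013467_00 ∷ 0x031567_00 ∷ 0x094578_00 ∷ 0x123450876_05 ∷ 0x0123456789_06 ∷ [])
    ((202000100 ∷ 000000000 ∷ 101000000 ∷ 000000101 ∷ []) ∷ (220102222 ∷ []) ∷ (022212222 ∷ []) ∷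
     (222221020 ∷ []) ∷ [])
    (0x01567a_00 ∷ 0x018_01 ∷ 0x234561087_05 ∷ 0x021456789a_06 ∷ 0x015_01 ∷ 0x016_01 ∷ 0x017_01 ∷ []) [] ∷
  dominated (1001000 ∷ 100000 ∷ 10000 ∷ 1000 ∷ 000 ∷ 10 ∷ 1 ∷ 0 ∷ []) 5 7
    (0x067_01 ∷ 0x012_01 ∷ 0x034_01 ∷ 0x052378_00 ∷ 0x023_01 ∷ 0x015_01 ∷ 0x045_01 ∷ 0x013478_00 ∷
     0x024578_00 ∷ 0x031578_00 ∷ 0x041278_00 ∷ 0x123450678_05 ∷ 0x123456780_07 ∷ 0x154326780_07 ∷
     0x215436780_07 ∷ 0x234516780_07 ∷ 0x345126780_07 ∷ []) ∷
  coloured (1001000001 ∷ 100000000 ∷ 10001100 ∷ 1000001 ∷ 001100 ∷ 11001 ∷ 0100 ∷ 010 ∷ 11 ∷ 0 ∷ 0 ∷ [])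
    (1 ∷ 2 ∷ 1 ∷ 0 ∷ 2 ∷ 3 ∷ 2 ∷ 0 ∷ 0 ∷ 3 ∷ 2 ∷ [])
    (0x012_01 ∷ 0x04b_01 ∷ 0x067_01 ∷ 0x038_01 ∷ 0x09a_01 ∷ 0x015_01 ∷ 0x023_01 ∷ 0x058_01 ∷ 0x06b_01 ∷
     0x045_01 ∷ 0x09b_01 ∷ 0x08a_01 ∷ 0x034_01 ∷ 0x024b8a_00 ∷ 0x01b_01 ∷ 0x0a1267_00 ∷ 0x068_01 ∷
     0x07128a_00 ∷ 0x071b38_00 ∷ 0x024567_00 ∷ 0x039_01 ∷ 0x06129a_00 ∷ 0x079_01 ∷ 0x031567_00 ∷ 0x0a236b_00 ∷
     0x0a3467_00 ∷ 0x12345067_08 ∷ 0x12345076_08 ∷ 0x679a8021_08 ∷ 0x059_01 ∷ 0x041279_00 ∷ 0x04128a_00 ∷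
     0x052367_00 ∷ 0x074b8a_00 ∷ 0x081279_00 ∷ 0x0a1567_00 ∷ [])
    ((00101000000 ∷ 00100100010 ∷ 00001100010 ∷ 00101100010 ∷ 00100010010 ∷ 10100010010 ∷ 00101010010 ∷
     00101000001 ∷ 00100010011 ∷ 00001010011 ∷ 01001010011 ∷ 00101010011 ∷ []) ∷ (01010100000 ∷ 01010001000 ∷
     01000011000 ∷ 01010011000 ∷ 01010000100 ∷ 01010100100 ∷ 01010001100 ∷ 01000100010 ∷ 01010100010 ∷
     01001100010 ∷ 01000010001 ∷ 01001010001 ∷ 01000011001 ∷ 01000010011 ∷ []) ∷ (10220202220 ∷ []) ∷
     (20022022200 ∷ []) ∷ [])
    (0x013_01 ∷ 0x01b_01 ∷ 0x014_01 ∷ 0x016_01 ∷ 0x012379_00 ∷ 0x01c_01 ∷ 0x01238a_00 ∷ 0x012_01 ∷ 0x01d_01 ∷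
     0x04297a_00 ∷ 0x042c8d_00 ∷ 0x04296d_00 ∷ 0x01347c_00 ∷ [])
    ((00000000001 , 10100010010 , 0 , 1) ∷ []) ∷
  coloured (1001000001 ∷ 100000000 ∷ 10001100 ∷ 1000001 ∷ 001100 ∷ 11000 ∷ 0100 ∷ 010 ∷ 11 ∷ 0 ∷ 0 ∷ [])
    (1 ∷ 3 ∷ 0 ∷ 1 ∷ 0 ∷ 0 ∷ 2 ∷ 2 ∷ 1 ∷ 0 ∷ 0 ∷ [])
    (0x079_01 ∷ 0x038_01 ∷ 0x01b_01 ∷ 0x068_01 ∷ 0x08a_01 ∷ 0x067_01 ∷ 0x09a_01 ∷ 0x02689b_00 ∷ 0x04b_01 ∷
     0x058_01 ∷ 0x091268_00 ∷ 0x0b2367_00 ∷ 0x059_01 ∷ 0x024567_00 ∷ 0x039_01 ∷ 0x031567_00 ∷ 0x013467_00 ∷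
     0x081279_00 ∷ 0x0a1267_00 ∷ 0x021b468a_08 ∷ 0x12345076_08 ∷ [])
    ((22010021200 ∷ 12020021200 ∷ 12010022100 ∷ 22020021100 ∷ []) ∷ (02202212021 ∷ 01202222021 ∷ 01000011002 ∷
     00101000001 ∷ []) ∷ (22222100222 ∷ []) ∷ (20222020020 ∷ []) ∷ [])
    (0x019_01 ∷ 0x01c_01 ∷ 0x015_01 ∷ 0x012_01 ∷ 0x01a_01 ∷ 0x018_01 ∷ 0x013_01 ∷ 0x3260487a9b1_09 ∷
     0x017_01 ∷ 0x0179ac_00 ∷ []) [] ∷
  coloured (10010000 ∷ 1000000 ∷ 100000 ∷ 10011 ∷ 0000 ∷ 110 ∷ 01 ∷ 0 ∷ 0 ∷ [])
    (2 ∷ 1 ∷ 0 ∷ 1 ∷ 0 ∷ 3 ∷ 0 ∷ 0 ∷ 3 ∷ [])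
    (0x012_01 ∷ 0x049_01 ∷ 0x015_01 ∷ 0x067_01 ∷ 0x079_01 ∷ 0x034_01 ∷ 0x068_01 ∷ 0x024567_00 ∷ 0x052367_00 ∷
     0x013467_00 ∷ 0x031567_00 ∷ 0x048_01 ∷ 0x061249_00 ∷ 0x081279_00 ∷ 0x091268_00 ∷ 0x041267_00 ∷
     0x03215679_08 ∷ 0x08679123_08 ∷ 0x12345067_08 ∷ 0x48679012_08 ∷ [])
    ((000000000 ∷ 100100000 ∷ 010100000 ∷ 000101000 ∷ 100101000 ∷ 010101000 ∷ []) ∷ (101001000 ∷ 101000100 ∷
     101000010 ∷ 101000110 ∷ 101000001 ∷ 100001001 ∷ 001001001 ∷ 101001001 ∷ 001011001 ∷ 101000011 ∷
     001010011 ∷ []) ∷ (012221222 ∷ 012212222 ∷ 022211222 ∷ []) ∷ (222220120 ∷ []) ∷ [])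
    (0x014_01 ∷ 0x012_01 ∷ 0x017_01 ∷ 0x01a_01 ∷ 0x013_01 ∷ 0x01348a_00 ∷ 0x015_01 ∷ 0x018_01 ∷ 0x01268a_00 ∷
     0x016_01 ∷ 0x072489_00 ∷ [])
    ((100001000 , 010100000 , 0 , 1) ∷ []) ∷
  coloured (1000010 ∷ 100100 ∷ 10000 ∷ 1000 ∷ 100 ∷ 00 ∷ 1 ∷ 0 ∷ []) (1 ∷ 3 ∷ 0 ∷ 1 ∷ 0 ∷ 1 ∷ 0 ∷ 2 ∷ [])
    (0x012_01 ∷ 0x078_01 ∷ 0x023_01 ∷ 0x045_01 ∷ 0x061734_00 ∷ 0x034_01 ∷ 0x081245_00 ∷ 0x026_01 ∷ 0x056_01 ∷
     0x024578_00 ∷ 0x031756_00 ∷ 0x042678_00 ∷ 0x052378_00 ∷ 0x03456178_08 ∷ 0x780214536_0b ∷ [])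
    ((01010000 ∷ 00010100 ∷ 10010100 ∷ 00010001 ∷ 01010001 ∷ 00010101 ∷ []) ∷ (01001000 ∷ 00101000 ∷
     00001010 ∷ 00101010 ∷ 00001001 ∷ 01001001 ∷ 00101001 ∷ []) ∷ (22222210 ∷ []) ∷ (10222222 ∷ []) ∷ [])
    (0x016_01 ∷ 0x015_01 ∷ 0x012867_00 ∷ 0x012_01 ∷ 0x013956_00 ∷ 0x013489_00 ∷ 0x018_01 ∷ 0x072a34_00 ∷
     0x052839_00 ∷ [])
    ((00000000 , 00010101 , 0 , 1) ∷ []) ∷
  coloured (1010010 ∷ 100100 ∷ 10000 ∷ 1000 ∷ 100 ∷ 00 ∷ 1 ∷ 0 ∷ []) (2 ∷ 1 ∷ 0 ∷ 3 ∷ 1 ∷ 0 ∷ 0 ∷ 2 ∷ [])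
    (0x014_01 ∷ 0x026_01 ∷ 0x034_01 ∷ 0x017_01 ∷ 0x045_01 ∷ 0x078_01 ∷ 0x012_01 ∷ 0x052378_00 ∷ 0x035678_00 ∷
     0x063478_00 ∷ 0x23456087_08 ∷ 0x06234587_0c ∷ 0x024578_00 ∷ 0x042678_00 ∷ 0x02345687_0c ∷ 0x04326587_0c ∷
     0x14306578_0c ∷ [])
    ((00000000 ∷ 01010000 ∷ 01001000 ∷ 01010001 ∷ []) ∷ (10100100 ∷ 00010100 ∷ 00010110 ∷ 10100101 ∷
     00010101 ∷ []) ∷ (02222210 ∷ []) ∷ (22101222 ∷ 22201221 ∷ 22102221 ∷ []) ∷ [])
    (0x017_01 ∷ 0x013_01 ∷ 0x012_01 ∷ 0x019_01 ∷ 0x014589_00 ∷ 0x012867_00 ∷ 0x016789_00 ∷ 0x014_01 ∷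
     0x016_01 ∷ 0x01459a_00 ∷ 0x018_01 ∷ 0x9a213874650_09 ∷ 0xa9312874650_09 ∷ [])
    ((10000000 , 01010001 , 0 , 1) ∷ []) ∷
  coloured (100100 ∷ 10000 ∷ 1000 ∷ 100 ∷ 00 ∷ 1 ∷ 0 ∷ []) (0 ∷ 1 ∷ 0 ∷ 1 ∷ 2 ∷ 0 ∷ 1 ∷ [])
    (0x045_01 ∷ 0x012_01 ∷ 0x067_01 ∷ 0x023_01 ∷ 0x015_01 ∷ 0x013467_00 ∷ 0x052367_00 ∷ 0x12345067_08 ∷
     0x12345076_08 ∷ 0x01234567_0c ∷ 0x01234576_0c ∷ 0x02154367_0c ∷ 0x02154376_0c ∷ 0x03215476_0c ∷
     0x05123467_0c ∷ 0x05123476_0c ∷ 0x01234576_0d ∷ 0x02154367_0d ∷ 0x02154376_0d ∷ 0x03451276_0d ∷ [])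
    ((0200000 ∷ 0102000 ∷ 0100200 ∷ []) ∷ (2010220 ∷ []) ∷ (2221022 ∷ []) ∷ [])
    (0x012678_00 ∷ 0x014578_00 ∷ 0x013_01 ∷ 0x014_01 ∷ 0x015_01 ∷ []) [] ∷
  coloured (100 ∷ 00 ∷ 1 ∷ 0 ∷ []) (1 ∷ 0 ∷ 0 ∷ 1 ∷ [])
    (0x012_01 ∷ [])
    ((1000 ∷ []) ∷ (0100 ∷ []) ∷ (2212 ∷ []) ∷ (2221 ∷ []) ∷ [])
    (0x012_01 ∷ 0x013_01 ∷ 0x0123456_0e ∷ 0x014_01 ∷ 0x015_01 ∷ 0x012345_00 ∷ [])
    ((0000 , 1000 , 0 , 1) ∷ []) ∷
  coloured (1 ∷ 0 ∷ []) (1 ∷ 0 ∷ [])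
    (0x012_01 ∷ [])
    ((10 ∷ []) ∷ (01 ∷ []) ∷ (00 ∷ []) ∷ [])
    (0x012_01 ∷ 0x013_01 ∷ 0x0123_0f ∷ []) [] ∷
  coloured [] []
    []
    ((0 ∷ []) ∷ [])
    (0x01_10 ∷ []) [] ∷
  []

2K₂-diamond-K₄-free-colouring : ChromaticBound 1 1 3 3
2K₂-diamond-K₄-free-colouring G μ≤ τ≤ ω≤ = certificate⇒colourable certificate G
  (InducedMatchings≤⇒Avoids G μ≤ ∷ SharedCliques≤⇒Avoids G τ≤ ∷ Cliques≤⇒Avoids G ω≤ ∷ [])
  where
  certificate : Certificate 3 (matchingPattern 2 ∷ sharedCliquePattern 2 ∷ cliquePattern 4 ∷ []) []
  certificate = record { steps = 2K₂-diamond-K₄-steps ; steps-✓ = refl ; last-graph = refl }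

3K₂-K₃-free-colouring : ChromaticBound 2 1 2 4
3K₂-K₃-free-colouring G μ≤ _ ω≤ = certificate⇒colourable certificate G
  (InducedMatchings≤⇒Avoids G μ≤ ∷ Cliques≤⇒Avoids G ω≤ ∷ [])
  where
  certificate : Certificate 4 (matchingPattern 3 ∷ cliquePattern 3 ∷ []) []
  certificate = record { steps = 3K₂-K₃-steps ; steps-✓ = refl ; last-graph = refl }

2K₂-K₄-free-colouring : ChromaticBound 1 2 3 4
2K₂-K₄-free-colouring G μ≤ _ ω≤ = certificate⇒colourable certificate G
  (InducedMatchings≤⇒Avoids G μ≤ ∷ Cliques≤⇒Avoids G ω≤ ∷ [])
  where
  certificate : Certificate 4 (matchingPattern 2 ∷ cliquePattern 4 ∷ []) []
  certificate = record { steps = 2K₂-K₄-steps ; steps-✓ = refl ; last-graph = refl }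

2K₂-K₅-e-K₆-free-colouring : ChromaticBound 1 2 5 5
2K₂-K₅-e-K₆-free-colouring {N} G μ≤ τ≤ ω≤ = Certificate.certified-colouring certificate G
  (InducedMatchings≤⇒Avoids G μ≤ ∷ SharedCliques≤⇒Avoids G τ≤ ∷ Cliques≤⇒Avoids G ω≤ ∷ []) K₄-free-colouring
  where
  certificate :
    Certificate 5 (matchingPattern 2 ∷ sharedCliquePattern 3 ∷ cliquePattern 6 ∷ []) (cliquePattern 4)
  certificate = record { steps = 2K₂-K₅-e-K₆-steps ; steps-✓ = refl ; last-graph = refl }

  K₄-free-colouring : ∀ {n} {φ : Fin (suc n) → Fin N} → Injective _≡_ _≡_ φ →
    Avoids (restrict G φ) (cliquePattern 4) → Colourable (restrict G φ) 5
  K₄-free-colouring {φ = φ} φ-injective avoids = Colourable-mono (restrict G φ) (ℕ.n≤1+n 4)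
    (2K₂-K₄-free-colouring (restrict G φ)
      (InducedMatchings≤-restrict μ≤) (SharedCliques≤-restrict φ-injective τ≤)
      (Avoids⇒Cliques≤ (restrict G φ) avoids))
    where open Restriction G φ

-- The recursions

edgeless-colouring : (G : Graph V) → Cliques≤ G 1 → Colourable G 1
edgeless-colouring G ω≤ = (λ _ → zero) , λ x y x~y _ → ℕ.<-irrefl refl (ω≤ ((x~y ∷ []) ∷ [] ∷ []))

Cliques≤0⇒empty : (G : Graph V) → Cliques≤ G 0 → ¬ V
Cliques≤0⇒empty G ω≤ x = ℕ.<-irrefl refl (ω≤ {x ∷ []} ([] ∷ []))

Cliques≤-mono : (G : Graph V) → l ≤ m → Cliques≤ G l → Cliques≤ G m
Cliques≤-mono G l≤m ω≤ clique = ≤-trans (ω≤ clique) l≤m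

module _ (G : Graph (Fin N)) where

  open Adjacency G

  farFrom-colouring : ChromaticBound p t m k → InducedMatchings≤ G (suc p) → SharedCliques≤ G t → Cliques≤ G m →
    ∀ {u v} → u ~ v → ColourableOn G (FarFrom G u v) k
  farFrom-colouring bound μ≤ τ≤ ω≤ {u} {v} u~v = ColourableOn-induced (bound subgraph
    (InducedMatchings≤-apart u~v vertex-∈ μ≤)
    (SharedCliques≤-restrict vertex-injective τ≤) (Cliques≤-restrict ω≤))
    where
    open Induced G (farFrom? G u v)
    open Restriction G vertex

  private-colouring : ChromaticBound p t m k →
    InducedMatchings≤ G (suc p) → SharedCliques≤ G (suc t) → Cliques≤ G (suc m) →
    ∀ {u v} → u ~ v → ∀ a → ColourableOn G ((a ~_) ∩ FarFrom G u v) k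
  private-colouring bound μ≤ τ≤ ω≤ {u} {v} u~v a = ColourableOn-induced (bound subgraph
    (InducedMatchings≤-apart u~v (proj₂ ∘ vertex-∈) μ≤)
    (SharedCliques≤-joined (proj₁ ∘ vertex-∈) vertex-injective τ≤) (Cliques≤-joined (proj₁ ∘ vertex-∈) ω≤))
    where
    open Induced G (λ x → a ~? x ×-dec farFrom? G u v x)
    open Restriction G vertex

  neighbour-or-far : ∀ u v x → (CommonNeighbour G (u ∷ []) ∪ CommonNeighbour G (v ∷ []) ∪ FarFrom G u v) x
  neighbour-or-far u v x with x ~? u | x ~? v
  ... | yes x~u | _       = inj₁ (x~u ∷ [])
  ... | no _    | yes x~v = inj₂ (inj₁ (x~v ∷ []))
  ... | no x≁u  | no x≁v  = inj₂ (inj₂ (≁-sym x≁u , ≁-sym x≁v))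

  triangle-cover : ∀ a b c x →
    (FarFrom G a b ∪ (a ~_) ∩ FarFrom G b c ∪ (b ~_) ∩ FarFrom G a c ∪
      CommonNeighbour G (a ∷ b ∷ []) ∪ CommonNeighbour G (a ∷ c ∷ []) ∪ CommonNeighbour G (b ∷ c ∷ [])) x
  triangle-cover a b c x with a ~? x | b ~? x | c ~? x
  ... | no a≁x  | no b≁x  | _       = inj₁ (a≁x , b≁x)
  ... | yes a~x | no b≁x  | no c≁x  = inj₂ (inj₁ (a~x , b≁x , c≁x))
  ... | no a≁x  | yes b~x | no c≁x  = inj₂ (inj₂ (inj₁ (b~x , a≁x , c≁x)))
  ... | yes a~x | yes b~x | _       = inj₂ (inj₂ (inj₂ (inj₁ (~-sym a~x ∷ ~-sym b~x ∷ []))))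
  ... | yes a~x | no _    | yes c~x = inj₂ (inj₂ (inj₂ (inj₂ (inj₁ (~-sym a~x ∷ ~-sym c~x ∷ [])))))
  ... | no _    | yes b~x | yes c~x = inj₂ (inj₂ (inj₂ (inj₂ (inj₂ (~-sym b~x ∷ ~-sym c~x ∷ [])))))

edge-split : ChromaticBound p 1 (2 + m) k → ChromaticBound (suc p) 1 (2 + m) (suc m + (suc m + k))
edge-split {m = m} bound G μ≤ τ≤ ω≤ with clique-or-Cliques≤ G 1
... | inj₂ ω≤1 = Colourable-mono G (s≤s z≤n) (edgeless-colouring G ω≤1)
... | inj₁ (u ∷ v ∷ [] , _ , ((u~v ∷ []) ∷ _)) = ColourableOn-universal G (neighbour-or-far G u v)
  (ColourableOn-∪ G (commonNeighbour? G (u ∷ [])) (neighbourhood u)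
  (ColourableOn-∪ G (commonNeighbour? G (v ∷ [])) (neighbourhood v)
  (farFrom-colouring G bound μ≤ τ≤ ω≤ u~v)))
  where
  neighbourhood : ∀ x → ColourableOn G (CommonNeighbour G (x ∷ [])) (suc m)
  neighbourhood x = commonNeighbourhood-colouring G ([] ∷ []) τ≤ ω≤

g-recursion : ∀ p m → 2 + m + (2 + m + g (2 + p) (3 + m)) ≡ g (3 + p) (3 + m)
g-recursion p m = begin
  2 + m + (2 + m + g (2 + p) (3 + m))
    ≡⟨ solve 2 (λ m x → con 2 :+ m :+ (con 2 :+ m :+ x) := x :+ con 2 :* (con 2 :+ m))
      refl m (g (2 + p) (3 + m)) ⟩
  g (2 + p) (3 + m) + 2 * (2 + m)
    ≡⟨ cong (g (2 + p) (3 + m) +_) (ℕ.*-distribˡ-∸ 2 (3 + m) 1) ⟩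
  g (2 + p) (3 + m) + (2 * (3 + m) ∸ 2) ∎
  where
  open ≡-Reasoning
  open +-*-Solver

g-2-closed : ∀ p → g (3 + p) 2 ≡ 2 * (2 + p)
g-2-closed p = ≡-sym (ℕ.*-distribˡ-∸ 2 (3 + p) 1)

g-2-recursion : ∀ p → 2 + g (3 + p) 2 ≡ g (4 + p) 2
g-2-recursion p = begin
  2 + g (3 + p) 2  ≡⟨ cong (2 +_) (g-2-closed p) ⟩
  2 + 2 * (2 + p)  ≡⟨ ℕ.*-suc 2 (2 + p) ⟨
  2 * (3 + p)      ≡⟨ g-2-closed (suc p) ⟨
  g (4 + p) 2      ∎
  where open ≡-Reasoning

f-3-closed : ∀ p → f (3 + p) 3 ≡ 13 + 9 * p + 2 * p * p
f-3-closed p = begin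
  2 * (3 + p) * (3 + p) + 4 ∸ 3 * (3 + p)
    ≡⟨ cong (_∸ 3 * (3 + p)) (solve 1 (λ p → con 2 :* (con 3 :+ p) :* (con 3 :+ p) :+ con 4
      := con 3 :* (con 3 :+ p) :+ (con 13 :+ con 9 :* p :+ con 2 :* p :* p)) refl p) ⟩
  3 * (3 + p) + (13 + 9 * p + 2 * p * p) ∸ 3 * (3 + p)
    ≡⟨ ℕ.m+n∸m≡n (3 * (3 + p)) _ ⟩
  13 + 9 * p + 2 * p * p ∎
  where
  open ≡-Reasoning
  open +-*-Solver

f-recursion : ∀ p m → f (2 + p) (3 + m) + 2 * g (2 + p) (2 + m) + 3 * (1 + m) ≡ f (3 + p) (3 + m)
f-recursion p       (suc m) = cong (f (2 + p) (4 + m) + 2 * g (2 + p) (3 + m) +_) (ℕ.*-distribˡ-∸ 3 (4 + m) 2)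
f-recursion zero    zero    = refl
f-recursion (suc p) zero    = begin
  f (3 + p) 3 + 2 * g (3 + p) 2 + 3
    ≡⟨ cong₂ (λ x y → x + 2 * y + 3) (f-3-closed p) (g-2-closed p) ⟩
  13 + 9 * p + 2 * p * p + 2 * (2 * (2 + p)) + 3
    ≡⟨ solve 1 (λ p → con 13 :+ con 9 :* p :+ con 2 :* p :* p :+ con 2 :* (con 2 :* (con 2 :+ p)) :+ con 3
      := con 13 :+ con 9 :* (con 1 :+ p) :+ con 2 :* (con 1 :+ p) :* (con 1 :+ p)) refl p ⟩
  13 + 9 * (1 + p) + 2 * (1 + p) * (1 + p)
    ≡⟨ f-3-closed (suc p) ⟨
  f (4 + p) 3 ∎
  where
  open ≡-Reasoning
  open +-*-Solver

f-lower-bound : ∀ p m → 2 * (1 + p) ≤ f (2 + p) (3 + m)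
f-lower-bound zero    zero          = s≤s (s≤s z≤n)
f-lower-bound zero    (suc zero)    = s≤s (s≤s z≤n)
f-lower-bound zero    (suc (suc m)) = s≤s (s≤s z≤n)
f-lower-bound (suc p) m             = begin
  2 * (2 + p)
    ≡⟨ ℕ.*-suc 2 (1 + p) ⟩
  2 + 2 * (1 + p)
    ≡⟨ ℕ.+-comm 2 (2 * (1 + p)) ⟩
  2 * (1 + p) + 2
    ≤⟨ ℕ.+-mono-≤ (f-lower-bound p m) (≤-trans (ℕ.n≤1+n 2) (ℕ.m≤m*n 3 (1 + m))) ⟩
  f (2 + p) (3 + m) + 3 * (1 + m)
    ≤⟨ ℕ.+-monoˡ-≤ (3 * (1 + m)) (ℕ.m≤m+n _ _) ⟩
  f (2 + p) (3 + m) + 2 * g (2 + p) (2 + m) + 3 * (1 + m)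
    ≡⟨ f-recursion p m ⟩
  f (3 + p) (3 + m) ∎
  where open ℕ.≤-Reasoning

diamond-free-colouring : ∀ p m → ChromaticBound (1 + p) 1 (2 + m) (g (2 + p) (2 + m))
diamond-free-colouring zero zero G μ≤ τ≤ ω≤ =
  2K₂-diamond-K₄-free-colouring G μ≤ τ≤ (Cliques≤-mono G (ℕ.n≤1+n 2) ω≤)
diamond-free-colouring zero (suc m) G μ≤ τ≤ ω≤ =
  ω-colourable-from G 3 μ≤ τ≤ ℕ.≤-refl (2K₂-diamond-K₄-free-colouring G μ≤ τ≤) (ℕ.≤⇒≤′ (ℕ.m≤m+n 3 m)) ω≤
diamond-free-colouring (suc zero) zero G μ≤ τ≤ ω≤ = 3K₂-K₃-free-colouring G μ≤ τ≤ ω≤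
diamond-free-colouring (suc (suc p)) zero G μ≤ τ≤ ω≤ =
  subst (Colourable G) (g-2-recursion p) (edge-split (diamond-free-colouring (suc p) zero) G μ≤ τ≤ ω≤)
diamond-free-colouring (suc p) (suc m) G μ≤ τ≤ ω≤ =
  subst (Colourable G) (g-recursion p m) (edge-split (diamond-free-colouring p (suc m)) G μ≤ τ≤ ω≤)

triangle-split : ChromaticBound p 2 (3 + m) k → ChromaticBound p 1 (2 + m) l →
  (G : Graph (Fin N)) → InducedMatchings≤ G (suc p) → SharedCliques≤ G 2 → Cliques≤ G (3 + m) →
  ∀ {a b c} → Clique G (a ∷ b ∷ c ∷ []) → Colourable G (k + 2 * l + 3 * (1 + m))
triangle-split {m = m} {k} {l} far-bound private-bound G μ≤ τ≤ ω≤ {a} {b} {c}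
  ((a~b ∷ a~c ∷ []) ∷ (b~c ∷ []) ∷ [] ∷ []) = subst (Colourable G) colour-count
    (ColourableOn-universal G (triangle-cover G a b c)
    (ColourableOn-∪ G (farFrom? G a b) (farFrom-colouring G far-bound μ≤ τ≤ ω≤ a~b)
    (ColourableOn-∪ G (λ x → a ~? x ×-dec farFrom? G b c x) (private-colouring G private-bound μ≤ τ≤ ω≤ b~c a)
    (ColourableOn-∪ G (λ x → b ~? x ×-dec farFrom? G a c x) (private-colouring G private-bound μ≤ τ≤ ω≤ a~c b)
    (ColourableOn-∪ G (commonNeighbour? G (a ∷ b ∷ [])) (common a~b)
    (ColourableOn-∪ G (commonNeighbour? G (a ∷ c ∷ [])) (common a~c)
    (common b~c)))))))
  where
  open Adjacency G
  common : ∀ {x y} → x ~ y → ColourableOn G (CommonNeighbour G (x ∷ y ∷ [])) (suc m)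
  common x~y = commonNeighbourhood-colouring G ((x~y ∷ []) ∷ [] ∷ []) τ≤ ω≤
  colour-count : k + (l + (l + (suc m + (suc m + suc m)))) ≡ k + 2 * l + 3 * (1 + m)
  colour-count = solve 3 (λ x y z → x :+ (y :+ (y :+ (z :+ (z :+ z)))) := x :+ con 2 :* y :+ con 3 :* z)
    refl k l (1 + m)
    where open +-*-Solver

K₅-e-free-colouring : ∀ p m → ChromaticBound (1 + p) 2 m (f (2 + p) m)
K₅-e-free-colouring p 0 G μ≤ τ≤ ω≤ =
  (λ x → contradiction x (Cliques≤0⇒empty G ω≤)) , λ x → contradiction x (Cliques≤0⇒empty G ω≤)
K₅-e-free-colouring p 1 G μ≤ τ≤ ω≤ = edgeless-colouring G ω≤
K₅-e-free-colouring zero 2 G μ≤ τ≤ ω≤ = diamond-free-colouring 0 0 G μ≤ (Cliques≤⇒SharedCliques≤ G ω≤) ω≤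
K₅-e-free-colouring (suc p) 2 G μ≤ τ≤ ω≤ =
  diamond-free-colouring (suc p) 0 G μ≤ (Cliques≤⇒SharedCliques≤ G ω≤) ω≤
K₅-e-free-colouring zero 3 G μ≤ τ≤ ω≤ = 2K₂-K₄-free-colouring G μ≤ τ≤ ω≤
K₅-e-free-colouring zero 4 G μ≤ τ≤ ω≤ =
  Colourable-mono G (ℕ.n≤1+n 5) (2K₂-K₅-e-K₆-free-colouring G μ≤ τ≤ (Cliques≤-mono G (ℕ.n≤1+n 4) ω≤))
K₅-e-free-colouring zero (suc (suc (suc (suc (suc m))))) G μ≤ τ≤ ω≤ =
  ω-colourable-from G 5 μ≤ τ≤ ℕ.≤-refl (2K₂-K₅-e-K₆-free-colouring G μ≤ τ≤) (ℕ.≤⇒≤′ (ℕ.m≤m+n 5 m)) ω≤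
K₅-e-free-colouring (suc p) (suc (suc (suc m))) G μ≤ τ≤ ω≤ with clique-or-Cliques≤ G 2
... | inj₂ ω≤2 = Colourable-mono G (f-lower-bound (suc p) m) (subst (Colourable G) (g-2-closed p)
  (diamond-free-colouring (suc p) 0 G μ≤ (Cliques≤⇒SharedCliques≤ G ω≤2) ω≤2))
... | inj₁ (a ∷ b ∷ c ∷ [] , _ , triangle) = subst (Colourable G) (f-recursion p m)
  (triangle-split (K₅-e-free-colouring p (3 + m)) (diamond-free-colouring p m) G μ≤ τ≤ ω≤ triangle)

theorem3p7 : (p : ℕ) → 2 ≤ p → (n : ℕ) (G : Graph (Fin n)) →
    Free (pK2 p) G → Free K5-e G →
    (w : ℕ) → IsCliqueNumber G w → Colourable G (f p w)
theorem3p7 (suc (suc p)) (s≤s (s≤s z≤n)) n G pK₂-free K₅-e-free w (_ , no-clique) = K₅-e-free-colouring p w G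
  (pK₂-free⇒InducedMatchings≤ G pK₂-free) (K₅-e-free⇒SharedCliques≤ G K₅-e-free)
  (¬HasClique⇒Cliques≤ G no-clique)
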